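{- Let $N\ge 3$ and $1\le r\le N$, and write $N=qr+s$ with integers $q,s$ and $0\le s<r$. Consider all sets $R$ consisting of $r$ rim vertices of the wheel graph $W_{N+1}$ with central vertex $c$, and let $d_1,\ldots,d_r$ denote the cyclic intervals of $R$. (1) Among all such $R$, the number $\mathcal F_{W_{N+1}}(\{c\}\cup R)$ is maximized if and only if, in the cyclic interval sequence $(d_1,\ldots,d_r)$, the value $q+1$ appears $s$ times and the value $q$ appears $r-s$ times. The maximum value is $$F_{2(q+1)}^{\,s}F_{2q}^{\,r-s}.$$ (2) Among all such $R$, the number $\mathcal F_{W_{N+1}}(\{c\}\cup R)$ is minimized if and only if $(d_1,\ldots,d_r)$ is a permutation of $(N-r+1,1,\ldots,1)$ (with $r-1$ entries equal to $1$ after the first). The minimum value is $$F_{2(N-r+1)}.$$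
   Context: The wheel graph $W_{N+1}$ ($N\ge3$) has vertex set $\{c,v_1,\ldots,v_N\}$ and edges $\{v_i,v_{i+1}\}$ (indices modulo $N$) and $\{c,v_i\}$ for $1\le i\le N$; $c$ is the central vertex and the $v_i$ are the rim vertices. For a set $R=\{v_{a_1},\ldots,v_{a_r}\}$ of rim vertices with $1\le a_1<\cdots<a_r\le N$, the cyclic intervals are $d_i=a_{i+1}-a_i$ for $1\le i\le r-1$ and $d_r=a_1+N-a_r$. For a finite connected graph $G$ and $\varnothing\ne S\subseteq V(G)$, a rooted spanning forest of $G$ with root set $S$ is a spanning forest (an acyclic subgraph containing all vertices of $G$) in which each connected component contains exactly one vertex of $S$; $\mathcal F_G(S)$ denotes the number of such forests. Fibonacci numbers: $F_0=0$, $F_1=1$, $F_{n+2}=F_{n+1}+F_n$. -}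

module Defs where

open import Data.Empty using (⊥-elim)
open import Data.Fin using (Fin; zero; suc; toℕ; splitAt; finToFun; funToFin)
open import Data.Fin.Properties
  using (any?; all?; suc-injective; toℕ<n; toℕ-fromℕ<; injective⇒≤; splitAt⁻¹-↑ˡ;
         splitAt⁻¹-↑ʳ; finToFun-funToFin)
open import Data.Fin.Subset using (Subset; inside; outside; _∈_)
open import Data.Fin.Subset.Properties using (_∈?_)
open import Data.List using (List; []; _∷_; _++_; _∷ʳ_; map; filter; length; zipWith; allFin)
import Data.List.Membership.Propositional as List
open import Data.List.Membership.Propositional.Properties using (∈-allFin)
open import Data.List.Relation.Unary.Any using (here; there)
open import Data.Nat using (ℕ; zero; suc; _+_; _∸_; _≤_; _<_; s≤s; z≤n; _%_)
open import Data.Nat.DivMod using (_mod_; m%n<n; m<n⇒m%n≡m; n%n≡0)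
import Data.Nat.Properties as ℕ
open import Data.Product using (Σ; ∃; ∃-syntax; ∃!; _×_; _,_; proj₁; proj₂)
open import Data.Product.Properties using (≡-dec; ,-injective)
open import Data.Sum using (_⊎_; inj₁; inj₂; [_,_]′)
open import Data.Vec using ([]; _∷_)
open import Function using (_∘_)
open import Function.Definitions using (Injective)
open import Level using (0ℓ)
open import Relation.Binary using (Rel; Decidable)
open import Relation.Binary.Construct.Closure.ReflexiveTransitive using (Star; ε; _◅_; _◅◅_)
open import Relation.Binary.PropositionalEquality
  using (_≡_; _≢_; refl; sym; trans; cong; subst)
open import Relation.Nullary using (¬_; Dec; yes; no; ¬?; _×-dec_; _⊎-dec_; _→-dec_)
open import Relation.Nullary.Decidable using (map′)
open import Relation.Unary using (Pred)

import Data.Fin.Properties as Fin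

fib : ℕ → ℕ
fib 0             = 0
fib 1             = 1
fib (suc (suc n)) = fib (suc n) + fib n

next : ∀ {n} → Fin n → Fin n
next {suc n} i = suc (toℕ i) mod suc n

-- The order in which `ends` lists the two ends of an edge carries no meaning.
record Graph : Set where
  field
    order size : ℕ
    ends       : Fin size → Fin order × Fin order

  Vertex : Set
  Vertex = Fin order

  Edge : Set
  Edge = Fin size

  Joins : Edge → Vertex → Vertex → Set
  Joins e u v = ends e ≡ (u , v) ⊎ ends e ≡ (v , u)

  field
    loopless : ∀ e v → ¬ Joins e v v
    simple   : ∀ {e e′ u v} → Joins e u v → Joins e′ u v → e ≡ e′

module _ (G : Graph) where
  open Graph G

  -- A spanning subgraph of G is identified with its edge set H.
  module _ (H : Subset size) where

    Adjacent : Rel Vertex 0ℓ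
    Adjacent u v = ∃[ e ] e ∈ H × Joins e u v

    Connected : Rel Vertex 0ℓ
    Connected = Star Adjacent

    IsCycle : ∀ {k} → (Fin (3 + k) → Vertex) → Set
    IsCycle f = Injective _≡_ _≡_ f × (∀ i → Adjacent (f i) (f (next i)))

    Cycle : Set
    Cycle = ∃[ k ] Σ (Fin (3 + k) → Vertex) IsCycle

    Acyclic : Set
    Acyclic = ¬ Cycle

    -- Each component is named by any vertex v in it.
    IsRootedForest : Subset order → Set
    IsRootedForest S = Acyclic × (∀ v → ∃! _≡_ λ s → s ∈ S × Connected v s)

module _ {n} {R : Rel (Fin n) 0ℓ} (R? : Decidable R) where

  private
    -- Reachability through intermediate vertices in a list, as in the
    -- Floyd–Warshall algorithm.
    Via : List (Fin n) → Fin n → Fin n → Set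
    Via []       u v = u ≡ v ⊎ R u v
    Via (w ∷ ws) u v = Via ws u v ⊎ (Via ws u w × Via ws w v)

    via? : ∀ ws u v → Dec (Via ws u v)
    via? []       u v = (u Fin.≟ v) ⊎-dec R? u v
    via? (w ∷ ws) u v = via? ws u v ⊎-dec (via? ws u w ×-dec via? ws w v)

    via-base : ∀ ws {u v} → u ≡ v ⊎ R u v → Via ws u v
    via-base []       p = p
    via-base (w ∷ ws) p = inj₁ (via-base ws p)

    via-trans : ∀ {ws w u v} → w List.∈ ws → Via ws u w → Via ws w v → Via ws u v
    via-trans {x ∷ xs} (here refl) p q =
      inj₂ ([ (λ p → p) , proj₁ ]′ p , [ (λ q → q) , proj₂ ]′ q)
    via-trans (there w∈) (inj₁ p)        (inj₁ q)        = inj₁ (via-trans w∈ p q)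
    via-trans (there w∈) (inj₁ p)        (inj₂ (q , q′)) = inj₂ (via-trans w∈ p q , q′)
    via-trans (there w∈) (inj₂ (p , p′)) (inj₁ q)        = inj₂ (p , via-trans w∈ p′ q)
    via-trans (there w∈) (inj₂ (p , _))  (inj₂ (_ , q))  = inj₂ (p , q)

    via⇒star : ∀ ws {u v} → Via ws u v → Star R u v
    via⇒star []       (inj₁ refl)    = ε
    via⇒star []       (inj₂ r)       = r ◅ ε
    via⇒star (w ∷ ws) (inj₁ p)       = via⇒star ws p
    via⇒star (w ∷ ws) (inj₂ (p , q)) = via⇒star ws p ◅◅ via⇒star ws q

    star⇒via : ∀ {u v} → Star R u v → Via (allFin n) u v
    star⇒via ε        = via-base (allFin n) (inj₁ refl)
    star⇒via (r ◅ rs) =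
      via-trans (∈-allFin _) (via-base (allFin n) (inj₂ r)) (star⇒via rs)

  star? : Decidable (Star R)
  star? u v = map′ (via⇒star (allFin n)) star⇒via (via? (allFin n) u v)

module _ (G : Graph) where
  open Graph G

  module _ (H : Subset size) where

    adjacent? : Decidable (Adjacent G H)
    adjacent? u v = any? λ e → (e ∈? H) ×-dec
      (≡-dec Fin._≟_ Fin._≟_ (ends e) (u , v) ⊎-dec ≡-dec Fin._≟_ Fin._≟_ (ends e) (v , u))

    private
      isCycle? : ∀ {k} (f : Fin (3 + k) → Vertex) → Dec (IsCycle G H f)
      isCycle? f =
        map′ (λ inj {i} {j} → inj i j) (λ inj i j → inj)
          (all? λ i → all? λ j → (f i Fin.≟ f j) →-dec (i Fin.≟ j))
        ×-dec (all? λ i → adjacent? (f i) (f (next i)))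

      isCycle-≗ : ∀ {k} {f g : Fin (3 + k) → Vertex} → (∀ i → f i ≡ g i) → IsCycle G H f → IsCycle G H g
      isCycle-≗ {f = f} f≗g (inj , adj) =
        (λ {i} {j} eq → inj (trans (f≗g i) (trans eq (sym (f≗g j))))) ,
        λ i → subst (λ v → Adjacent G H v _) (f≗g i)
                (subst (Adjacent G H (f i)) (f≗g (next i)) (adj i))

    cycle? : Dec (Cycle G H)
    cycle? = map′
      (λ (k , c , isC) → toℕ k , finToFun c , isC)
      bounded
      (any? λ (k : Fin order) → any? λ c → isCycle? (finToFun {order} {3 + toℕ k} c))
      where
      bounded : Cycle G H → ∃[ k ] ∃[ c ] IsCycle G H (finToFun {order} {3 + toℕ {order} k} c)
      bounded (k , f , isC) = k′ , restore (sym (toℕ-fromℕ< k<))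
        where
        k< : k < order
        k< = ℕ.≤-trans (ℕ.m≤n+m (suc k) 2) (injective⇒≤ (proj₁ isC))
        k′ = Data.Fin.fromℕ< k<
        restore : ∀ {m} → k ≡ m → ∃[ c ] IsCycle G H (finToFun {order} {3 + m} c)
        restore refl =
          funToFin f , isCycle-≗ (λ i → sym (finToFun-funToFin f i)) isC

    isRootedForest? : (S : Subset order) → Dec (IsRootedForest G H S)
    isRootedForest? S = ¬? cycle? ×-dec all? λ v → unique? (root? v)
      where
      root? : ∀ v s → Dec (s ∈ S × Connected G H v s)
      root? v s = (s ∈? S) ×-dec star? adjacent? v s

      unique? : {P : Pred Vertex 0ℓ} → (∀ s → Dec (P s)) → Dec (∃! _≡_ P)
      unique? P? = map′
        (λ (s , p , u) → s , p , λ {t} → u t)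
        (λ (s , p , u) → s , p , λ t → u)
        (any? λ s → P? s ×-dec all? λ t → P? t →-dec (s Fin.≟ t))

subsets : ∀ n → List (Subset n)
subsets zero    = [] ∷ []
subsets (suc n) = map (inside ∷_) (subsets n) ++ map (outside ∷_) (subsets n)

𝓕 : (G : Graph) → Subset (Graph.order G) → ℕ
𝓕 G S = length (filter (λ H → isRootedForest? G H S) (subsets (Graph.size G)))

next-cases : ∀ {n} (i : Fin n) →
  toℕ (next i) ≡ suc (toℕ i) ⊎ (toℕ (next i) ≡ 0 × suc (toℕ i) ≡ n)
next-cases {suc n} i with ℕ.m≤n⇒m<n∨m≡n (toℕ<n i)
... | inj₁ lt = inj₁ (trans (toℕ-fromℕ< _) (m<n⇒m%n≡m lt))
... | inj₂ eq = inj₂ (trans (toℕ-fromℕ< _)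
                       (trans (cong (_% suc n) eq) (n%n≡0 (suc n))) , eq)

next≢ : ∀ {n} → 3 ≤ n → (i : Fin n) → next i ≢ i
next≢ 3≤n i eq with next-cases i
... | inj₁ p = ℕ.1+n≢n (trans (sym p) (cong toℕ eq))
... | inj₂ (p , q) with trans (sym p) (cong toℕ eq)
...   | 0≡i with subst (3 ≤_) (trans (sym q) (cong suc (sym 0≡i))) 3≤n
...     | s≤s ()

next-next≢ : ∀ {n} → 3 ≤ n → (i : Fin n) → next (next i) ≢ i
next-next≢ 3≤n i eq with next-cases i | next-cases (next i)
... | inj₁ p | inj₁ q =
  ℕ.m+1+n≢n 1 (trans (cong suc (sym p)) (trans (sym q) (cong toℕ eq)))
... | inj₁ p | inj₂ (q , q′) with trans (sym q) (cong toℕ eq)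
...   | 0≡i with subst (3 ≤_) (trans (sym q′) (cong suc (trans p (cong suc (sym 0≡i))))) 3≤n
...     | s≤s (s≤s ())
next-next≢ 3≤n i eq | inj₂ (p , p′) | inj₁ q
  with trans (sym (cong toℕ eq)) (trans q (cong suc p))
... | i≡1 with subst (3 ≤_) (trans (sym p′) (cong suc i≡1)) 3≤n
...   | s≤s (s≤s ())
next-next≢ 3≤n i eq | inj₂ (p , p′) | inj₂ (q , q′)
  with subst (3 ≤_) (trans (sym q′) (cong suc p)) 3≤n
... | s≤s ()

-- In the wheel, `zero` is the centre c and `suc i` is the rim vertex v_{i+1}.
wheelEnds : ∀ N → Fin (N + N) → Fin (suc N) × Fin (suc N)
wheelEnds N e = [ (λ i → suc i , suc (next i)) , (λ i → zero , suc i) ]′ (splitAt N e)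

wheel : (N : ℕ) → 3 ≤ N → Graph
wheel N 3≤N = record
  { order    = suc N
  ; size     = N + N
  ; ends     = wheelEnds N
  ; loopless = loopless
  ; simple   = simple
  }
  where
  Joins : Fin (N + N) → Fin (suc N) → Fin (suc N) → Set
  Joins e u v = wheelEnds N e ≡ (u , v) ⊎ wheelEnds N e ≡ (v , u)

  loopless′ : ∀ e v → wheelEnds N e ≢ (v , v)
  loopless′ e v eq with splitAt N e
  ... | inj₁ i with ,-injective eq
  ...   | refl , p = next≢ 3≤N i (suc-injective p)
  loopless′ e v eq | inj₂ i with ,-injective eq
  ... | refl , ()

  loopless : ∀ e v → ¬ Joins e v v
  loopless e v = [ loopless′ e v , loopless′ e v ]′

  same : ∀ e e′ → wheelEnds N e ≡ wheelEnds N e′ → e ≡ e′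
  same e e′ eq with splitAt N e in p | splitAt N e′ in p′
  ... | inj₁ i | inj₁ j with refl ← suc-injective (proj₁ (,-injective eq)) =
    trans (sym (splitAt⁻¹-↑ˡ p)) (splitAt⁻¹-↑ˡ p′)
  ... | inj₂ i | inj₂ j with refl ← suc-injective (proj₂ (,-injective eq)) =
    trans (sym (splitAt⁻¹-↑ʳ p)) (splitAt⁻¹-↑ʳ p′)
  same e e′ () | inj₁ i | inj₂ j
  same e e′ () | inj₂ i | inj₁ j

  opposite : ∀ e e′ {u v} → wheelEnds N e ≡ (u , v) → wheelEnds N e′ ≢ (v , u)
  opposite e e′ eq eq′ with splitAt N e | splitAt N e′
  opposite e e′ refl eq′ | inj₁ i | inj₁ j with ,-injective eq′
  ... | p , q with refl ← suc-injective p = next-next≢ 3≤N i (suc-injective q)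
  opposite e e′ refl () | inj₁ i | inj₂ j
  opposite e e′ refl () | inj₂ i | inj₁ j
  opposite e e′ refl () | inj₂ i | inj₂ j

  simple : ∀ {e e′ u v} → Joins e u v → Joins e′ u v → e ≡ e′
  simple {e} {e′} (inj₁ p) (inj₁ q) = same e e′ (trans p (sym q))
  simple {e} {e′} (inj₂ p) (inj₂ q) = same e e′ (trans p (sym q))
  simple {e} {e′} (inj₁ p) (inj₂ q) = ⊥-elim (opposite e e′ p q)
  simple {e} {e′} (inj₂ p) (inj₁ q) = ⊥-elim (opposite e e′ p q)

-- {c} ∪ R, for a set R of rim vertices (i ∈ R meaning v_{i+1} ∈ R).
hub∪_ : ∀ {N} → Subset N → Subset (suc N)
hub∪ R = inside ∷ R

-- a₁ < ⋯ < a_r, numbered from 1.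
rimIndices : ∀ {N} → Subset N → List ℕ
rimIndices {N} R = map (suc ∘ toℕ) (filter (_∈? R) (allFin N))

-- The differences between (a₂, …, a_r, a₁ + N) and (a₁, …, a_r).
cyclicGaps : ℕ → List ℕ → List ℕ
cyclicGaps N []       = []
cyclicGaps N (a ∷ as) = zipWith _∸_ (as ∷ʳ (a + N)) (a ∷ as)

cyclicIntervals : ∀ {N} → Subset N → List ℕ
cyclicIntervals {N} R = cyclicGaps N (rimIndices R)

occurrences : ℕ → List ℕ → ℕ
occurrences x xs = length (filter (x ℕ.≟_) xs)

module _ {A : Set} (P : Pred A 0ℓ) (f : A → ℕ) where

  IsMaximizer IsMinimizer : A → Set
  IsMaximizer x = P x × (∀ y → P y → f y ≤ f x)
  IsMinimizer x = P x × (∀ y → P y → f x ≤ f y)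

  IsMaximum IsMinimum : ℕ → Set
  IsMaximum m = ∃[ x ] IsMaximizer x × f x ≡ m
  IsMinimum m = ∃[ x ] IsMinimizer x × f x ≡ m

{-# OPTIONS --safe #-}

-- The missing rim edges cut the rim into arcs, and a subgraph is a rooted forest exactly when some
-- rim edge is missing and each arc carries one mark, a root or a spoke.  This is a local condition along
-- the rim, so the forests are counted by the trace of a product of 2 × 2 transfer matrices:
-- (2 1; 1 1), whose powers consist of Fibonacci numbers, for a vertex outside R, and a matrix of
-- rank one for a root.  The trace therefore splits into a product of F_{2d} over the cyclic
-- intervals d.  Since d ↦ F_{2d} is strictly log-concave, a multiplicative tangent line through
-- d = q and d = q + 1 gives the maximum; the identity
-- F_{2(a+1)} F_{2(b+1)} = F_{2(a+b+1)} + F_{2a} F_{2b} shows that merging two intervals into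
-- one long and one of length 1 decreases the product, which gives the minimum.

module Submission where

open import Defs
open import Data.Bool using (Bool; true; false; _∨_; _∧_; if_then_else_)
import Data.Bool.Properties as Bool
open import Data.Empty using (⊥; ⊥-elim)
open import Data.Fin using (Fin; zero; suc; toℕ; fromℕ; inject₁; fromℕ<; splitAt; _↑ˡ_; _↑ʳ_)
open import Data.Fin.Properties
  using (toℕ-injective; toℕ<n; toℕ-fromℕ; toℕ-inject₁; toℕ-fromℕ<; splitAt-↑ˡ; splitAt-↑ʳ;
         splitAt⁻¹-↑ˡ; splitAt⁻¹-↑ʳ; any?)
import Data.Fin.Properties as Fin
open import Data.Fin.Subset using (Subset; ∣_∣; _∈_; _∉_)
open import Data.Fin.Subset.Properties using (_∈?_)
open import Data.List as List
  using (List; []; _∷_; _∷ʳ_; map; filter; length; replicate; allFin; zipWith)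
open import Data.List.Membership.Propositional.Properties using (∈-allFin)
open import Data.List.Properties
  using (filter-++; filter-accept; filter-reject; length-++; length-map; length-replicate;
         map-tabulate; map-∘; map-cong)
open import Data.List.Relation.Binary.Permutation.Propositional
  using (_↭_; ↭-refl; ↭-prep; ↭-swap; ↭-trans)
import Data.List.Relation.Binary.Permutation.Propositional.Properties as Perm
open import Data.List.Relation.Unary.All as All using (All; []; _∷_)
import Data.List.Relation.Unary.All.Properties as All
open import Data.Maybe using (Maybe; just; nothing; _>>=_)
open import Data.Nat
open import Data.Nat.DivMod
  using (_mod_; m<n⇒m%n≡m; n%n≡0; [m+n]%n≡m%n; [m+kn]%n≡m%n; m≡m%n+[m/n]*n)
open import Data.Nat.Induction using (<-wellFounded)
open import Data.Nat.ListAction using (sum; product)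
open import Data.Nat.ListAction.Properties using (sum-++; product-↭)
open import Data.Nat.Properties
open import Data.Nat.Tactic.RingSolver using (solve-∀)
open import Data.Product using (∃; ∃-syntax; _×_; _,_; proj₁; proj₂)
open import Data.Sum using (_⊎_; inj₁; inj₂; [_,_]′; swap; map₁; map₂)
open import Data.Vec as Vec using ([]; _∷_; here; there; lookup; _++_)
open import Data.Vec.Properties using (lookup⇒[]=; []=⇒lookup; lookup-++ˡ; lookup-++ʳ)
open import Function using (_∘_; id)
open import Function.Bundles using (_⇔_; mk⇔)
open import Function.Definitions using (Injective)
open import Induction.WellFounded using (Acc; acc)
open import Level using (0ℓ)
open import Relation.Binary using (Rel; Decidable; tri<; tri≈; tri>)
open import Relation.Binary.Construct.Closure.ReflexiveTransitive as Star
  using (Star; ε; _◅_; _◅◅_)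
open import Relation.Binary.PropositionalEquality
open import Relation.Nullary using (¬_; Dec; yes; no; does; _×-dec_; _⊎-dec_)
open import Relation.Unary using (Pred) renaming (Decidable to Decidable₁)
open import Data.List.Extrema ≤-totalOrder using (argmax; f[xs]≤f[argmax])

-- Acyclicity and uniqueness of roots are conditions on whole paths, whereas a transfer matrix sees
-- one vertex at a time; a Boolean state at each rim vertex bridges the two. Given the states, every
-- vertex outside the root set is directed along one edge towards its root, and a strictly
-- decreasing rank certifies at once that there is no cycle and that every chain of parents ends in
-- a root. Given the forest, the state records whether a mark lies behind on the same arc. A spoke
-- counts as a mark because the centre is itself a root.
--
-- The roots in R do two further jobs. An unbroken rim would carry the mark of a root all the way
-- round to that root again, where it is rejected, so they enforce a missing rim edge. They also
-- erase the earlier state, so a subgraph has at most one consistent family of states and the trace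
-- counts each forest once.

prev : ∀ {n} → Fin n → Fin n
prev {suc n} zero    = fromℕ n
prev         (suc i) = inject₁ i

next-injective : ∀ {n} {i j : Fin n} → next i ≡ next j → i ≡ j
next-injective {i = i} {j} eq with next-cases i | next-cases j
... | inj₁ p       | inj₁ q       =
  toℕ-injective (suc-injective (trans (sym p) (trans (cong toℕ eq) q)))
... | inj₁ p       | inj₂ (q , _) = ⊥-elim (1+n≢0 (trans (sym p) (trans (cong toℕ eq) q)))
... | inj₂ (p , _) | inj₁ q       = ⊥-elim (1+n≢0 (trans (sym q) (trans (sym (cong toℕ eq)) p)))
... | inj₂ (_ , p) | inj₂ (_ , q) = toℕ-injective (suc-injective (trans p (sym q)))

next-prev : ∀ {n} (i : Fin n) → next (prev i) ≡ i
next-prev {suc n} zero with next-cases (fromℕ n)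
... | inj₂ (p , _) = toℕ-injective p
... | inj₁ p       =
  ⊥-elim (<-irrefl (trans p (cong suc (toℕ-fromℕ n))) (toℕ<n (next (fromℕ n))))
next-prev (suc i) with next-cases (inject₁ i)
... | inj₁ p       = toℕ-injective (trans p (cong suc (toℕ-inject₁ i)))
... | inj₂ (_ , p) =
  ⊥-elim (<-irrefl (trans (sym (toℕ-inject₁ i)) (suc-injective p)) (toℕ<n i))

-- Rooted forests from a parent relation

maximal : ∀ {n} → Fin n → (f : Fin n → ℕ) → ∃[ i ] ∀ j → f j ≤ f i
maximal i₀ f = argmax f i₀ (allFin _) ,
  λ j → All.lookup (f[xs]≤f[argmax] i₀ (allFin _)) (∈-allFin j)

module _ (G : Graph) (H : Subset (Graph.size G)) (S : Subset (Graph.order G))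
  (Parent : Rel (Graph.Vertex G) 0ℓ)
  (parent-unique   : ∀ {u v w} → Parent u v → Parent u w → v ≡ w)
  (parent⇒adjacent : ∀ {u v} → Parent u v → Adjacent G H u v)
  (adjacent⇒parent : ∀ {u v} → Adjacent G H u v → Parent u v ⊎ Parent v u)
  (root-orphan     : ∀ {u v} → u ∈ S → ¬ Parent u v)
  (parent-exists   : ∀ {u} → u ∉ S → ∃ (Parent u))
  (rank            : Graph.Vertex G → ℕ)
  (parent-rank     : ∀ {u v} → Parent u v → rank v < rank u)
  where

  open Graph G using (Vertex)

  private
    -- Both neighbours of a vertex of maximal rank on a cycle would be its parent.
    no-cycle : ∀ {n} → 3 ≤ n → (f : Fin n → Vertex) → Injective _≡_ _≡_ f →
      ¬ (∀ i → Adjacent G H (f i) (f (next i)))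
    no-cycle 3≤n f f-inj f-adj with maximal (fromℕ< 3≤n) (rank ∘ f)
    ... | top , below-top = next-next≢ 3≤n (prev top)
      (f-inj (parent-unique (after (next-prev top)) before))
      where
      above : ∀ {i} → ¬ Parent (f i) (f top)
      above p = <⇒≱ (parent-rank p) (below-top _)

      before : Parent (f top) (f (prev top))
      before = [ ⊥-elim ∘ above , id ]′
        (adjacent⇒parent (subst (Adjacent G H (f (prev top)) ∘ f) (next-prev top) (f-adj (prev top))))

      after : ∀ {i} → i ≡ top → Parent (f top) (f (next i))
      after refl = [ id , ⊥-elim ∘ above ]′ (adjacent⇒parent (f-adj _))

    acyclic : Acyclic G H
    acyclic (_ , f , f-inj , f-adj) = no-cycle (s≤s (s≤s (s≤s z≤n))) f f-inj f-adj

    ancestor : ∀ v → Acc _<_ (rank v) → ∃[ s ] s ∈ S × Star Parent v s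
    ancestor v (acc rec) with v ∈? S
    ... | yes v∈S = v , v∈S , ε
    ... | no  v∉S with parent-exists v∉S
    ...   | u , p with ancestor u (rec (parent-rank p))
    ...     | s , s∈S , ps = s , s∈S , p ◅ ps

    -- Walk along the path to `t` while keeping the parent chain from the current vertex to `s`: an
    -- edge towards a child lengthens the chain, an edge towards the parent removes its first link.
    -- At `t`, a root without parent, the chain must be empty.
    ancestor-unique : ∀ {v s t} → s ∈ S → Star Parent v s → t ∈ S → Connected G H v t → s ≡ t
    ancestor-unique s∈S ε        t∈S ε = refl
    ancestor-unique s∈S (p ◅ ps) t∈S ε = ⊥-elim (root-orphan t∈S p)
    ancestor-unique s∈S ps       t∈S (a ◅ as) with adjacent⇒parent a
    ... | inj₂ q = ancestor-unique s∈S (q ◅ ps) t∈S as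
    ancestor-unique s∈S ε        t∈S (a ◅ as) | inj₁ q = ⊥-elim (root-orphan s∈S q)
    ancestor-unique s∈S (p ◅ ps) t∈S (a ◅ as) | inj₁ q with refl ← parent-unique p q =
      ancestor-unique s∈S ps t∈S as

  parent⇒rootedForest : IsRootedForest G H S
  parent⇒rootedForest = acyclic , λ v →
    let s , s∈S , ps = ancestor v (<-wellFounded (rank v))
    in s , (s∈S , Star.map parent⇒adjacent ps) ,
       λ (t∈S , c) → ancestor-unique s∈S ps t∈S c

-- Rotations of the rim

shift : ∀ {n} → ℕ → Fin n → Fin n
shift zero    i = i
shift (suc t) i = next (shift t i)

shift-next : ∀ {n} t (i : Fin n) → shift t (next i) ≡ next (shift t i)
shift-next zero    i = refl
shift-next (suc t) i = cong next (shift-next t i)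

toℕ-shift : ∀ {n} t (i : Fin (suc n)) → toℕ (shift t i) ≡ (t + toℕ i) % suc n
toℕ-shift zero    i = sym (m<n⇒m%n≡m (toℕ<n i))
toℕ-shift {n} (suc t) i = begin
  toℕ (next (shift t i))              ≡⟨ toℕ-fromℕ< _ ⟩
  suc (toℕ (shift t i)) % suc n       ≡⟨ cong (λ k → suc k % suc n) (toℕ-shift t i) ⟩
  suc ((t + toℕ i) % suc n) % suc n   ≡⟨ [m+kn]%n≡m%n (suc ((t + toℕ i) % suc n)) ((t + toℕ i) / suc n) (suc n) ⟨
  suc ((t + toℕ i) % suc n + (t + toℕ i) / suc n * suc n) % suc n
                                      ≡⟨ cong (λ k → suc k % suc n) (m≡m%n+[m/n]*n (t + toℕ i) (suc n)) ⟨
  suc (t + toℕ i) % suc n             ∎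
  where open ≡-Reasoning

-- Since `t + toℕ i` is below twice the length of the rim, reduction modulo that length subtracts it
-- at most once. A fixed point would force `t` to be zero without the subtraction and the full
-- length with it.
shift-≢ : ∀ {n} t (i : Fin n) → 0 < t → t < n → shift t i ≢ i
shift-≢ {suc n} t i 0<t t<n eq with toℕ-shift t i | t + toℕ i <? suc n
... | p | yes lt = <⇒≢ (+-monoˡ-< (toℕ i) 0<t)
  (sym (trans (sym (m<n⇒m%n≡m lt)) (trans (sym p) (cong toℕ eq))))
... | p | no  ge = <⇒≢ (+-monoˡ-< (toℕ i) t<n) (trans (sym wrap) (+-comm _ (suc n)))
  where
  w = (t + toℕ i) ∸ suc n
  w+n : w + suc n ≡ t + toℕ i
  w+n = m∸n+n≡m (≮⇒≥ ge)
  w<n : w < suc n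
  w<n = +-cancelʳ-< (suc n) w (suc n)
    (subst (_< suc n + suc n) (sym w+n) (+-mono-< t<n (toℕ<n i)))
  w≡i : w ≡ toℕ i
  w≡i = begin
    w                   ≡⟨ m<n⇒m%n≡m w<n ⟨
    w % suc n           ≡⟨ [m+n]%n≡m%n w (suc n) ⟨
    (w + suc n) % suc n ≡⟨ cong (_% suc n) w+n ⟩
    (t + toℕ i) % suc n ≡⟨ p ⟨
    toℕ (shift t i)     ≡⟨ cong toℕ eq ⟩
    toℕ i               ∎
    where open ≡-Reasoning
  wrap : toℕ i + suc n ≡ t + toℕ i
  wrap = trans (cong (_+ suc n) (sym w≡i)) w+n

shift-injective : ∀ {n} s t (i : Fin n) → s < n → t < n → shift s i ≡ shift t i → s ≡ t
shift-injective zero    zero    i s<n t<n eq = refl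
shift-injective zero    (suc t) i s<n t<n eq = ⊥-elim (shift-≢ (suc t) i z<s t<n (sym eq))
shift-injective (suc s) zero    i s<n t<n eq = ⊥-elim (shift-≢ (suc s) i z<s s<n eq)
shift-injective (suc s) (suc t) i s<n t<n eq =
  cong suc (shift-injective s t i (<⇒≤ s<n) (<⇒≤ t<n) (next-injective eq))

shift-surjective : ∀ {n} (i j : Fin n) → ∃[ t ] t < n × shift t i ≡ j
shift-surjective {suc n} i j with toℕ i ≤? toℕ j
... | yes i≤j = toℕ j ∸ toℕ i , ≤-<-trans (m∸n≤m (toℕ j) (toℕ i)) (toℕ<n j) , toℕ-injective (begin
  toℕ (shift (toℕ j ∸ toℕ i) i)       ≡⟨ toℕ-shift (toℕ j ∸ toℕ i) i ⟩
  (toℕ j ∸ toℕ i + toℕ i) % suc n     ≡⟨ cong (_% suc n) (m∸n+n≡m i≤j) ⟩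
  toℕ j % suc n                       ≡⟨ m<n⇒m%n≡m (toℕ<n j) ⟩
  toℕ j                               ∎)
  where open ≡-Reasoning
... | no  i≰j = toℕ j + (suc n ∸ toℕ i) , bound , toℕ-injective (begin
  toℕ (shift (toℕ j + (suc n ∸ toℕ i)) i)     ≡⟨ toℕ-shift (toℕ j + (suc n ∸ toℕ i)) i ⟩
  (toℕ j + (suc n ∸ toℕ i) + toℕ i) % suc n   ≡⟨ cong (_% suc n) (+-assoc (toℕ j) _ _) ⟩
  (toℕ j + (suc n ∸ toℕ i + toℕ i)) % suc n   ≡⟨ cong (λ k → (toℕ j + k) % suc n) (m∸n+n≡m (<⇒≤ (toℕ<n i))) ⟩
  (toℕ j + suc n) % suc n                     ≡⟨ [m+n]%n≡m%n (toℕ j) (suc n) ⟩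
  toℕ j % suc n                               ≡⟨ m<n⇒m%n≡m (toℕ<n j) ⟩
  toℕ j                                       ∎)
  where
  open ≡-Reasoning
  bound : toℕ j + (suc n ∸ toℕ i) < suc n
  bound = subst (toℕ j + (suc n ∸ toℕ i) <_) (m+[n∸m]≡n (<⇒≤ (toℕ<n i)))
    (+-monoˡ-< (suc n ∸ toℕ i) (≰⇒> i≰j))

-- Rooted forests of the wheel as labellings of the rim

-- An arc is a maximal run of rim edges of a subgraph H, and its marks are the roots and spokes it
-- meets.  In step c ρ x y, at a rim vertex v: c says whether the arc entering v already carries a
-- mark, ρ whether v is a root, x and y whether H contains the rim edge leaving v and the spoke
-- at v.  The result is the value of c at the next vertex; it is nothing if an arc acquires a
-- second mark or ends without one.
step : Bool → Bool → Bool → Bool → Maybe Bool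
step false false true  false = just false
step false false x     true  = just x
step false true  x     false = just x
step true  false x     false = just x
step _     _     _     _     = nothing

step-just : ∀ c ρ x y {d} → step c ρ x y ≡ just d → d ≡ x ∧ (c ∨ ρ ∨ y)
step-just false false true  false refl = refl
step-just false false true  true  refl = refl
step-just false false false true  refl = refl
step-just false true  true  false refl = refl
step-just false true  false false refl = refl
step-just true  false true  false refl = refl
step-just true  false false false refl = refl

step-excl : ∀ c ρ x y {d} → step c ρ x y ≡ just d → c ≡ true → ρ ≡ true ⊎ y ≡ true → ⊥
step-excl true false x false eq refl (inj₁ ())
step-excl true false x false eq refl (inj₂ ())

step-excl′ : ∀ c ρ x y {d} → step c ρ x y ≡ just d → ρ ≡ true → y ≡ true → ⊥
step-excl′ false true x false eq refl ()

step-unmarked : ∀ c ρ x y {d} → step c ρ x y ≡ just d → c ∨ ρ ∨ y ≡ false → x ≡ true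
step-unmarked false false true false eq p = refl

-- The three hypotheses are the local forest conditions: a carried mark meets no other, a root has
-- no spoke, and an arc that is cut has a mark.
step-intro : ∀ c ρ x y → ¬ (c ≡ true × (ρ ≡ true ⊎ y ≡ true)) → ¬ (ρ ≡ true × y ≡ true) →
  (x ≡ false → c ∨ ρ ∨ y ≡ true) → step c ρ x y ≡ just (x ∧ (c ∨ ρ ∨ y))
step-intro false false false false p q r with () ← r refl
step-intro false false true  false p q r = refl
step-intro false false false true  p q r = refl
step-intro false false true  true  p q r = refl
step-intro false true  false false p q r = refl
step-intro false true  true  false p q r = refl
step-intro false true  x     true  p q r = ⊥-elim (q (refl , refl))
step-intro true  false false false p q r = refl
step-intro true  false true  false p q r = refl
step-intro true  false x     true  p q r = ⊥-elim (p (refl , inj₂ refl))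
step-intro true  true  x     y     p q r = ⊥-elim (p (refl , inj₁ refl))

wheelEnds-↑ˡ : ∀ {N} (i : Fin N) → wheelEnds N (i ↑ˡ N) ≡ (suc i , suc (next i))
wheelEnds-↑ˡ {N} i rewrite splitAt-↑ˡ N i N = refl

wheelEnds-↑ʳ : ∀ {N} (i : Fin N) → wheelEnds N (N ↑ʳ i) ≡ (zero , suc i)
wheelEnds-↑ʳ {N} i rewrite splitAt-↑ʳ N N i = refl

module _ {N : ℕ} (3≤N : 3 ≤ N) (R x y : Subset N) where

  private
    G : Graph
    G = wheel N 3≤N

    H : Subset (N + N)
    H = x ++ y

  -- Edges of `H` directed as `wheelEnds` lists them, so that later case splits see a rim edge or a
  -- spoke instead of `splitAt` on an edge number.
  data Link : Rel (Fin (suc N)) 0ℓ where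
    rim   : ∀ {i} → lookup x i ≡ true → Link (suc i) (suc (next i))
    spoke : ∀ {i} → lookup y i ≡ true → Link zero (suc i)

  link⇒joins : ∀ {u v} → Link u v → ∃[ e ] e ∈ H × wheelEnds N e ≡ (u , v)
  link⇒joins (rim {i} p)   = i ↑ˡ N ,
    lookup⇒[]= _ H (trans (lookup-++ˡ x y i) p) , wheelEnds-↑ˡ i
  link⇒joins (spoke {i} p) = N ↑ʳ i ,
    lookup⇒[]= _ H (trans (lookup-++ʳ x y i) p) , wheelEnds-↑ʳ i

  joins⇒link : ∀ {u v} e → e ∈ H → wheelEnds N e ≡ (u , v) → Link u v
  joins⇒link e e∈H eq with splitAt N e in p
  joins⇒link e e∈H refl | inj₁ i with refl ← splitAt⁻¹-↑ˡ {N} {N} {e} p =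
    rim (trans (sym (lookup-++ˡ x y i)) ([]=⇒lookup e∈H))
  joins⇒link e e∈H refl | inj₂ i with refl ← splitAt⁻¹-↑ʳ {N} {N} {e} p =
    spoke (trans (sym (lookup-++ʳ x y i)) ([]=⇒lookup e∈H))

  link⇒adjacent : ∀ {u v} → Link u v → Adjacent G H u v
  link⇒adjacent l with e , e∈H , eq ← link⇒joins l = e , e∈H , inj₁ eq

  link⇒adjacent⁻ : ∀ {u v} → Link u v → Adjacent G H v u
  link⇒adjacent⁻ l with e , e∈H , eq ← link⇒joins l = e , e∈H , inj₂ eq

  adjacent⇒link : ∀ {u v} → Adjacent G H u v → Link u v ⊎ Link v u
  adjacent⇒link (e , e∈H , inj₁ eq) = inj₁ (joins⇒link e e∈H eq)
  adjacent⇒link (e , e∈H , inj₂ eq) = inj₂ (joins⇒link e e∈H eq)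

  -- A closed walk of the automaton `step` around the rim.
  Labelling : (Fin N → Bool) → Set
  Labelling c = ∀ i → step (c i) (lookup R i) (lookup x i) (lookup y i) ≡ just (c (next i))

  private
    S : Subset (suc N)
    S = hub∪ R

  -- From labellings to rooted forests

  module _ {c : Fin N → Bool} (labelling : Labelling c)
    {a : Fin N} (Ra : lookup R a ≡ true) where

    private
      m : Fin N → Bool
      m i = c i ∨ lookup R i ∨ lookup y i

      -- Each non-root rim vertex points towards the single mark of its arc: to the centre if it
      -- bears the spoke, back if the mark was already passed, ahead if the mark is still to come.
      data Parent : Rel (Fin (suc N)) 0ℓ where
        hub   : ∀ {i} → lookup y i ≡ true → Parent (suc i) zero
        back  : ∀ {i j} → next j ≡ i → c i ≡ true → Parent (suc i) (suc j)
        ahead : ∀ {i} → m i ≡ false → Parent (suc i) (suc (next i))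

      c-next : ∀ i → c (next i) ≡ lookup x i ∧ m i
      c-next i = step-just (c i) (lookup R i) (lookup x i) (lookup y i) (labelling i)

      c-excl : ∀ {i} → c i ≡ true → lookup R i ≡ true ⊎ lookup y i ≡ true → ⊥
      c-excl {i} = step-excl (c i) (lookup R i) (lookup x i) (lookup y i) (labelling i)

      ρ-excl : ∀ {i} → lookup R i ≡ true → lookup y i ≡ true → ⊥
      ρ-excl {i} = step-excl′ (c i) (lookup R i) (lookup x i) (lookup y i) (labelling i)

      unmarked : ∀ {i} → m i ≡ false → lookup x i ≡ true
      unmarked {i} = step-unmarked (c i) (lookup R i) (lookup x i) (lookup y i) (labelling i)

      c⇒m : ∀ {i} → c i ≡ true → m i ≡ true
      c⇒m {i} p = cong (_∨ (lookup R i ∨ lookup y i)) p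

      R⇒m : ∀ {i} → lookup R i ≡ true → m i ≡ true
      R⇒m {i} p = trans (cong (λ b → c i ∨ b ∨ lookup y i) p) (Bool.∨-zeroʳ (c i))

      y⇒m : ∀ {i} → lookup y i ≡ true → m i ≡ true
      y⇒m {i} p = trans (cong (λ b → c i ∨ lookup R i ∨ b) p)
        (trans (cong (c i ∨_) (Bool.∨-zeroʳ (lookup R i))) (Bool.∨-zeroʳ (c i)))

      clash : ∀ {b} → b ≡ true → b ≡ false → ⊥
      clash p q with () ← trans (sym p) q

      parent-unique : ∀ {u v w} → Parent u v → Parent u w → v ≡ w
      parent-unique (hub p)    (hub q)    = refl
      parent-unique (hub p)    (back _ q) = ⊥-elim (c-excl q (inj₂ p))
      parent-unique (hub p)    (ahead q)  = ⊥-elim (clash (y⇒m p) q)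
      parent-unique (back _ p) (hub q)    = ⊥-elim (c-excl p (inj₂ q))
      parent-unique (back e p) (back f q) = cong suc (next-injective (trans e (sym f)))
      parent-unique (back _ p) (ahead q)  = ⊥-elim (clash (c⇒m p) q)
      parent-unique (ahead p)  (hub q)    = ⊥-elim (clash (y⇒m q) p)
      parent-unique (ahead p)  (back _ q) = ⊥-elim (clash (c⇒m q) p)
      parent-unique (ahead p)  (ahead q)  = refl

      ∧-true : ∀ a {b} → a ∧ b ≡ true → a ≡ true × b ≡ true
      ∧-true true p = refl , p

      c-next-true : ∀ {i} → c (next i) ≡ true → lookup x i ≡ true × m i ≡ true
      c-next-true {i} p = ∧-true (lookup x i) (trans (sym (c-next i)) p)

      parent⇒adjacent : ∀ {u v} → Parent u v → Adjacent G H u v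
      parent⇒adjacent (hub p)       = link⇒adjacent⁻ (spoke p)
      parent⇒adjacent (back refl p) = link⇒adjacent⁻ (rim (proj₁ (c-next-true p)))
      parent⇒adjacent (ahead p)     = link⇒adjacent (rim (unmarked p))

      link⇒parent : ∀ {u v} → Link u v → Parent u v ⊎ Parent v u
      link⇒parent (spoke p)   = inj₂ (hub p)
      link⇒parent (rim {i} p) with m i in eq
      ... | true  = inj₂ (back refl (trans (c-next i) (cong₂ _∧_ p eq)))
      ... | false = inj₁ (ahead eq)

      adjacent⇒parent : ∀ {u v} → Adjacent G H u v → Parent u v ⊎ Parent v u
      adjacent⇒parent = [ link⇒parent , swap ∘ link⇒parent ]′ ∘ adjacent⇒link

      root-orphan : ∀ {u v} → u ∈ S → ¬ Parent u v
      root-orphan (there i∈R) (hub p)    = ρ-excl ([]=⇒lookup i∈R) p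
      root-orphan (there i∈R) (back _ p) = c-excl p (inj₁ ([]=⇒lookup i∈R))
      root-orphan (there i∈R) (ahead p)  = clash (R⇒m ([]=⇒lookup i∈R)) p

      parent-exists : ∀ {u} → u ∉ S → ∃ (Parent u)
      parent-exists {zero}  u∉S = ⊥-elim (u∉S here)
      parent-exists {suc i} u∉S with lookup y i in yi | c i in ci | lookup R i in Ri
      ... | true  | _     | _     = zero , hub yi
      ... | false | true  | _     = suc (prev i) , back (next-prev i) ci
      ... | false | false | true  = ⊥-elim (u∉S (there (lookup⇒[]= i R Ri)))
      ... | false | false | false = suc (next i) , ahead (cong₂ _∨_ ci (cong₂ _∨_ Ri yi))

      -- Numbers the rim cyclically from a to a + N − 1, so that only the step into the root a descends.
      pos : Fin N → ℕ
      pos i with toℕ i <? toℕ a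
      ... | yes _ = N + toℕ i
      ... | no  _ = toℕ i

      pos-< : ∀ i → pos i < N + N
      pos-< i with toℕ i <? toℕ a
      ... | yes _ = +-monoʳ-< N (toℕ<n i)
      ... | no  _ = ≤-trans (toℕ<n i) (m≤m+n N N)

      pos-next : ∀ i → next i ≢ a → pos (next i) ≡ suc (pos i)
      pos-next i i≢ with next-cases i | toℕ i <? toℕ a | toℕ (next i) <? toℕ a
      ... | inj₁ p       | yes i<a | yes _   = trans (cong (N +_) p) (+-suc N (toℕ i))
      ... | inj₁ p       | yes i<a | no  i≮a =
        ⊥-elim (i≢ (toℕ-injective (≤-antisym (subst (_≤ toℕ a) (sym p) i<a) (≮⇒≥ i≮a))))
      ... | inj₁ p       | no  i≮a | yes i<a =
        ⊥-elim (i≮a (<-trans (n<1+n _) (subst (_< toℕ a) p i<a)))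
      ... | inj₁ p       | no  _   | no  _   = p
      ... | inj₂ (p , q) | yes i<a | _       = ⊥-elim (<⇒≱ (toℕ<n a) (subst (_≤ toℕ a) q i<a))
      ... | inj₂ (p , q) | no  _   | yes _   = trans (cong (N +_) p) (trans (+-identityʳ N) (sym q))
      ... | inj₂ (p , q) | no  _   | no  i≮a =
        ⊥-elim (i≢ (toℕ-injective (trans p (sym (n≤0⇒n≡0 (subst (toℕ a ≤_) p (≮⇒≥ i≮a)))))))

      -- Marked vertices point back, so their rank grows with `pos`; unmarked ones point ahead, so
      -- theirs falls. Marked ranks are at most `N + N` and unmarked ranks exceed it, hence passing
      -- from an unmarked to a marked vertex also descends. The `suc` keeps rim vertices above the
      -- centre.
      rank : Fin (suc N) → ℕ
      rank zero    = 0
      rank (suc i) = if m i then suc (pos i) else (N + N) + ((N + N) ∸ pos i)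

      rank-marked : ∀ {i} → m i ≡ true → rank (suc i) ≡ suc (pos i)
      rank-marked p rewrite p = refl

      rank-unmarked : ∀ {i} → m i ≡ false → rank (suc i) ≡ (N + N) + ((N + N) ∸ pos i)
      rank-unmarked p rewrite p = refl

      -- The drop of `pos` at `a` does no harm. A root is entered with state `false`, so no `back`
      -- arrow leaves `a`; it is marked, so an `ahead` arrow into it falls below the offset.
      parent-rank : ∀ {u v} → Parent u v → rank v < rank u
      parent-rank (hub p) rewrite y⇒m p = z<s
      parent-rank (back {j = j} refl p)
        rewrite rank-marked (c⇒m p) | rank-marked (proj₂ (c-next-true p))
              | pos-next j (λ e → c-excl p (inj₁ (trans (cong (lookup R) e) Ra))) = ≤-refl
      parent-rank (ahead {i} p) rewrite rank-unmarked p with m (next i) in eq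
      ... | true  = ≤-<-trans (pos-< (next i)) (m<m+n (N + N) (m<n⇒0<n∸m (pos-< i)))
      ... | false rewrite pos-next i (λ e → clash (R⇒m (trans (cong (lookup R) e) Ra)) eq) =
        +-monoʳ-< (N + N) (∸-monoʳ-< (n<1+n (pos i)) (pos-< i))

    labelling⇒rootedForest : IsRootedForest G H S
    labelling⇒rootedForest = parent⇒rootedForest G H S Parent parent-unique parent⇒adjacent
      adjacent⇒parent root-orphan parent-exists rank parent-rank

  -- From rooted forests to labellings

  module _ (forest : IsRootedForest G H S) where

    private
      root-unique : ∀ {v s t} → s ∈ S → t ∈ S → Connected G H v s → Connected G H v t → s ≡ t
      root-unique {v} s∈S t∈S p q with _ , _ , unique ← proj₂ forest v =
        trans (sym (unique (s∈S , p))) (unique (t∈S , q))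

      no-cycle : ∀ {n} → 3 ≤ n → (f : Fin n → Fin (suc N)) → Injective _≡_ _≡_ f →
        ¬ (∀ i → Adjacent G H (f i) (f (next i)))
      no-cycle (s≤s (s≤s (s≤s z≤n))) f f-inj f-adj = proj₁ forest (_ , f , f-inj , f-adj)

      not-full : ¬ (∀ i → lookup x i ≡ true)
      not-full p = no-cycle 3≤N suc Fin.suc-injective λ i → link⇒adjacent (rim (p i))

      Forward : Rel (Fin N) 0ℓ
      Forward i j = lookup x i ≡ true × next i ≡ j

      Marked : Fin N → Set
      Marked i = lookup R i ≡ true ⊎ lookup y i ≡ true

      -- `Carried i` is the intended meaning of the state on entering `i`, and `Reached i` that of
      -- "marked up to and including `i`". Both are decidable by `star?`, so the state can be read
      -- off as a Boolean.
      Reached : Fin N → Set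
      Reached i = ∃[ k ] Marked k × Star Forward k i

      Carried : Fin N → Set
      Carried i = ∃[ j ] Forward j i × Reached j

      forward? : Decidable Forward
      forward? i j = (lookup x i Bool.≟ true) ×-dec (next i Fin.≟ j)

      reached? : ∀ i → Dec (Reached i)
      reached? i = any? λ k → ((lookup R k Bool.≟ true) ⊎-dec (lookup y k Bool.≟ true))
        ×-dec star? forward? k i

      carried? : ∀ i → Dec (Carried i)
      carried? i = any? λ j → forward? j i ×-dec reached? j

      forward⇒connected : ∀ {i j} → Star Forward i j → Connected G H (suc i) (suc j)
      forward⇒connected = Star.gmap suc λ { (p , refl) → link⇒adjacent (rim p) }

      -- Unlike `Star Forward`, this exposes the length of the path, which is needed to tell whether
      -- it wraps around the rim.
      Run : ℕ → Rel (Fin N) 0ℓ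
      Run t i j = shift t i ≡ j × (∀ s → s < t → lookup x (shift s i) ≡ true)

      forward⇒run : ∀ {i j} → Star Forward i j → ∃[ t ] Run t i j
      forward⇒run ε = 0 , refl , λ _ ()
      forward⇒run {i} ((p , refl) ◅ ps) with t , e , q ← forward⇒run ps =
        suc t , trans (sym (shift-next t i)) e , λ where
          zero    _       → p
          (suc s) (s≤s h) → subst (λ j → lookup x j ≡ true) (shift-next s i) (q s h)

      -- A run of `N` or more steps would use every rim edge and close the rim into a cycle.
      run-< : ∀ {t i j} → Run t i j → t < N
      run-< {t} {i} (_ , q) with t <? N
      ... | yes t<N = t<N
      ... | no  t≮N = ⊥-elim (not-full λ k →
        let s , s<N , e = shift-surjective i k
        in subst (λ j → lookup x j ≡ true) e (q s (<-≤-trans s<N (≮⇒≥ t≮N))))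

      -- A run between two spokes closes up to a cycle through the centre.
      spokes-apart : ∀ {t i j} → Run (suc t) i j → lookup y i ≡ true → lookup y j ≡ true → ⊥
      spokes-apart {t} {i} run@(refl , q) yi yj =
        no-cycle (s≤s (s≤s (s≤s (z≤n {t})))) (F ∘ toℕ) F-inj F-adj
        where
        F : ℕ → Fin (suc N)
        F zero    = zero
        F (suc s) = suc (shift s i)

        F-inj′ : ∀ a b → a < 3 + t → b < 3 + t → F a ≡ F b → a ≡ b
        F-inj′ zero    zero    _       _       _ = refl
        F-inj′ (suc a) (suc b) (s≤s p) (s≤s r) e = cong suc (shift-injective a b i
          (≤-<-trans (≤-pred p) (run-< run)) (≤-<-trans (≤-pred r) (run-< run)) (Fin.suc-injective e))

        F-inj : Injective _≡_ _≡_ (F ∘ toℕ {3 + t})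
        F-inj {a} {b} e = toℕ-injective (F-inj′ (toℕ a) (toℕ b) (toℕ<n a) (toℕ<n b) e)

        ascend : ∀ a → suc a < 3 + t → Adjacent G H (F a) (F (suc a))
        ascend zero    _             = link⇒adjacent (spoke yi)
        ascend (suc a) (s≤s (s≤s h)) = link⇒adjacent (rim (q a h))

        F-adj : ∀ k → Adjacent G H (F (toℕ k)) (F (toℕ {3 + t} (next k)))
        F-adj k with next-cases k
        ... | inj₁ p       rewrite p = ascend (toℕ k) (subst (_< 3 + t) p (toℕ<n (next k)))
        ... | inj₂ (p , e) rewrite p | suc-injective e = link⇒adjacent⁻ (spoke yj)

      rim∈S : ∀ {i} → lookup R i ≡ true → suc i ∈ S
      rim∈S p = there (lookup⇒[]= _ R p)

      root-no-spoke : ∀ {i} → ¬ (lookup R i ≡ true × lookup y i ≡ true)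
      root-no-spoke (p , q) with () ← root-unique (rim∈S p) here ε (link⇒adjacent⁻ (spoke q) ◅ ε)

      -- Two marks on one arc always contradict the forest. Two roots, or a root and a spoke, put
      -- two members of `S` into one component; the two roots differ because the run is shorter than
      -- the rim. Two spokes close a cycle.
      carried-unmarked : ∀ {i} → Carried i → ¬ Marked i
      carried-unmarked {i} (j , (xj , refl) , k , mk , ps) mi with forward⇒run ps
      ... | t , e , q = marks mk mi
        where
        arc : Connected G H (suc k) (suc (next j))
        arc = forward⇒connected (ps ◅◅ (xj , refl) ◅ ε)

        run : Run (suc t) k (next j)
        run = cong next e , λ s s<1+t → [ q s , (λ { refl → subst (λ j → lookup x j ≡ true) (sym e) xj }) ]′
          (m≤n⇒m<n∨m≡n (≤-pred s<1+t))

        marks : Marked k → Marked (next j) → ⊥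
        marks (inj₁ p) (inj₁ r) = shift-≢ (suc t) k z<s (run-< run)
          (trans (proj₁ run) (Fin.suc-injective (sym (root-unique (rim∈S p) (rim∈S r) ε arc))))
        marks (inj₁ p) (inj₂ r)
          with () ← root-unique (rim∈S p) here ε (arc ◅◅ link⇒adjacent⁻ (spoke r) ◅ ε)
        marks (inj₂ p) (inj₁ r)
          with () ← root-unique here (rim∈S r) (link⇒adjacent⁻ (spoke p) ◅ ε) arc
        marks (inj₂ p) (inj₂ r) = spokes-apart run p r

      -- Otherwise the arc ending at i would be a component without a root.
      cut⇒reached : ∀ i → lookup x i ≡ false → Reached i
      cut⇒reached i xi with reached? i
      ... | yes r = r
      ... | no ¬r with s , (s∈S , conn) , _ ← proj₂ forest (suc i) =
        ⊥-elim (rootless s s∈S (closed* conn ε))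
        where
        Arc : Fin (suc N) → Set
        Arc zero    = ⊥
        Arc (suc j) = Star Forward j i

        -- There is no way out: the rim edge leaving `i` is absent, a backward rim edge only
        -- lengthens the arc, and a spoke would be a mark from which `i` is reached.
        closed : ∀ {u v} → Adjacent G H u v → Arc u → Arc v
        closed adj arc with adjacent⇒link adj
        closed adj ε               | inj₁ (rim p) with () ← trans (sym p) xi
        closed adj ((_ , refl) ◅ ps) | inj₁ (rim p) = ps
        closed adj arc             | inj₂ (rim p)   = (p , refl) ◅ arc
        closed adj arc             | inj₂ (spoke p) = ¬r (_ , inj₂ p , arc)

        closed* : ∀ {u v} → Connected G H u v → Arc u → Arc v
        closed* ε        arc = arc
        closed* (a ◅ as) arc = closed* as (closed a arc)

        rootless : ∀ s → s ∈ S → ¬ Arc s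
        rootless (suc j) (there j∈R) arc = ¬r (j , inj₁ ([]=⇒lookup j∈R) , arc)

      unsnoc : ∀ {i j} → Star Forward i j → i ≡ j ⊎ (∃[ k ] Star Forward i k × Forward k j)
      unsnoc ε        = inj₁ refl
      unsnoc (p ◅ ps) with unsnoc ps
      ... | inj₁ refl         = inj₂ (_ , ε , p)
      ... | inj₂ (k , qs , q) = inj₂ (k , p ◅ qs , q)

      reached⇒marked∨carried : ∀ {i} → Reached i → Marked i ⊎ Carried i
      reached⇒marked∨carried (k , mk , ps) with unsnoc ps
      ... | inj₁ refl         = inj₁ mk
      ... | inj₂ (j , qs , q) = inj₂ (j , q , k , mk , qs)

      c : Fin N → Bool
      c i = does (carried? i)

      m : Fin N → Bool
      m i = c i ∨ lookup R i ∨ lookup y i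

      c⇒carried : ∀ {i} → c i ≡ true → Carried i
      c⇒carried {i} p with yes q ← carried? i = q

      m⇒reached : ∀ {i} → m i ≡ true → Reached i
      m⇒reached {i} p with carried? i | lookup R i in Ri | lookup y i in yi
      ... | yes (j , f , k , mk , ps) | _    | _    = k , mk , ps ◅◅ f ◅ ε
      ... | no  _                     | true | _    = i , inj₁ Ri , ε
      ... | no  _                     | false | true = i , inj₂ yi , ε

      reached⇒m : ∀ {i} → Reached i → m i ≡ true
      reached⇒m {i} r with carried? i | lookup R i in Ri | lookup y i in yi | reached⇒marked∨carried r
      ... | yes _ | _     | _     | _             = refl
      ... | no  _ | true  | _     | _             = refl
      ... | no  _ | false | true  | _             = refl
      ... | no ¬p | false | false | inj₂ p        = ⊥-elim (¬p p)
      ... | no ¬p | false | false | inj₁ (inj₁ ())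
      ... | no ¬p | false | false | inj₁ (inj₂ ())

      -- Injectivity of `next` makes `i` the only vertex that can carry a mark into `next i`.
      c-next : ∀ i → c (next i) ≡ lookup x i ∧ m i
      c-next i with carried? (next i) | lookup x i in xi | m i in mi
      ... | yes _                  | true  | true  = refl
      ... | yes (j , (xj , e) , r) | false | _     with refl ← next-injective e
                                                   with () ← trans (sym xi) xj
      ... | yes (j , (xj , e) , r) | true  | false with refl ← next-injective e
                                                   with () ← trans (sym mi) (reached⇒m r)
      ... | no ¬p                  | true  | true  = ⊥-elim (¬p (i , (xi , refl) , m⇒reached mi))
      ... | no _                   | true  | false = refl
      ... | no _                   | false | _     = refl

    rootedForest⇒labelling : ∃ Labelling
    rootedForest⇒labelling = c , λ i → trans
      (step-intro (c i) (lookup R i) (lookup x i) (lookup y i)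
        (λ (p , q) → carried-unmarked (c⇒carried p) q) root-no-spoke
        (λ p → reached⇒m (cut⇒reached i p)))
      (cong just (sym (c-next i)))

-- Counting labellings

-- The automaton on the rim cut open before its first vertex; a labelling is a run that ends in its
-- starting state.
run : ∀ {n} → Bool → Subset n → Subset n → Subset n → Maybe Bool
run c []      []      []      = just c
run c (ρ ∷ R) (a ∷ x) (b ∷ y) = step c ρ a b >>= λ d → run d R x y

-- The open walk over `n` vertices has `n + 1` states, hence the index in `ℕ`; closing up becomes
-- the separate equation between the states at `n` and `0`.
Labels : ∀ {n} → (ℕ → Bool) → Subset n → Subset n → Subset n → Set
Labels c R x y = ∀ i → step (c (toℕ i)) (lookup R i) (lookup x i) (lookup y i) ≡ just (c (suc (toℕ i)))

run⇒labels : ∀ {n c d} (R x y : Subset n) → run c R x y ≡ just d →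
  ∃[ f ] f 0 ≡ c × f n ≡ d × Labels f R x y
run⇒labels {c = c} [] [] [] refl = (λ _ → c) , refl , refl , λ ()
run⇒labels {c = c} (ρ ∷ R) (a ∷ x) (b ∷ y) eq with step c ρ a b in s
... | just c′ with f , refl , fn , l ← run⇒labels R x y eq =
  (λ { zero → c ; (suc k) → f k }) , refl , fn , λ { zero → s ; (suc i) → l i }

labels⇒run : ∀ {n} f (R x y : Subset n) → Labels f R x y → run (f 0) R x y ≡ just (f n)
labels⇒run f [] [] [] l = refl
labels⇒run f (ρ ∷ R) (a ∷ x) (b ∷ y) l rewrite l zero = labels⇒run (f ∘ suc) R x y (l ∘ suc)

module _ {N : ℕ} (3≤N : 3 ≤ N) (R x y : Subset N) where

  run⇒labelling : ∀ {c} → run c R x y ≡ just c → ∃ (Labelling 3≤N R x y)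
  run⇒labelling eq with f , f0 , fN , l ← run⇒labels R x y eq =
    f ∘ toℕ , λ i → trans (l i) (cong just (wrap f (trans fN (sym f0)) i))
    where
    wrap : ∀ f → f N ≡ f 0 → ∀ (i : Fin N) → f (suc (toℕ i)) ≡ f (toℕ (next i))
    wrap f e i with next-cases i
    ... | inj₁ p       = cong f (sym p)
    ... | inj₂ (p , q) = trans (cong f q) (trans e (cong f (sym p)))

labelling⇒run : ∀ {N} (3≤N : 3 ≤ N) (R x y : Subset N) →
  ∃ (Labelling 3≤N R x y) → ∃[ c ] run c R x y ≡ just c
labelling⇒run {suc n} 3≤N R x y (c , l) = f 0 ,
  trans (labels⇒run f R x y labels) (cong (just ∘ c) N-mod)
  where
  f : ℕ → Bool
  f k = c (k mod suc n)

  toℕ-mod : ∀ (i : Fin (suc n)) → toℕ i mod suc n ≡ i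
  toℕ-mod i = toℕ-injective (trans (toℕ-fromℕ< _) (m<n⇒m%n≡m (toℕ<n i)))

  N-mod : suc n mod suc n ≡ 0 mod suc n
  N-mod = toℕ-injective (trans (toℕ-fromℕ< _) (n%n≡0 (suc n)))

  labels : Labels f R x y
  labels i rewrite toℕ-mod i = l i

-- Every accepted step at a root starts in `false`, so from there on both runs agree. Consequently a
-- pair of edge sets cannot close up from both starting states.
run-deterministic : ∀ {n c c′ d d′} (R x y : Subset n) {a : Fin n} → lookup R a ≡ true →
  run c R x y ≡ just d → run c′ R x y ≡ just d′ → d ≡ d′
run-deterministic {c = false} {false} (true ∷ R) (a ∷ x) (false ∷ y) {zero} _ p q
  with refl ← trans (sym p) q = refl
run-deterministic {c = false} {false} (true ∷ R) (a ∷ x) (true ∷ y) {zero} _ ()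
run-deterministic {c = true}          (true ∷ R) (a ∷ x) (b ∷ y) {zero} _ ()
run-deterministic {c = false} {true}  (true ∷ R) (a ∷ x) (b ∷ y) {zero} _ _ ()
run-deterministic {c = c} {c′} (ρ ∷ R) (a ∷ x) (b ∷ y) {suc _} Ra p q
  with step c ρ a b | step c′ ρ a b
... | just _ | just _ = run-deterministic R x y Ra p q

-- Sums over edge sets and the trace formula

Σ⊆ : ∀ n → (Subset n → ℕ) → ℕ
Σ⊆ zero    f = f []
Σ⊆ (suc n) f = Σ⊆ n (f ∘ (true ∷_)) + Σ⊆ n (f ∘ (false ∷_))

Σ⊆-cong : ∀ n {f g} → (∀ x → f x ≡ g x) → Σ⊆ n f ≡ Σ⊆ n g
Σ⊆-cong zero    e = e []
Σ⊆-cong (suc n) e = cong₂ _+_ (Σ⊆-cong n (e ∘ (true ∷_))) (Σ⊆-cong n (e ∘ (false ∷_)))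

Σ⊆-zero : ∀ n → Σ⊆ n (λ _ → 0) ≡ 0
Σ⊆-zero zero    = refl
Σ⊆-zero (suc n) = cong₂ _+_ (Σ⊆-zero n) (Σ⊆-zero n)

Σ⊆-+ : ∀ n f g → Σ⊆ n (λ x → f x + g x) ≡ Σ⊆ n f + Σ⊆ n g
Σ⊆-+ zero    f g = refl
Σ⊆-+ (suc n) f g = trans (cong₂ _+_ (Σ⊆-+ n _ _) (Σ⊆-+ n _ _)) (interchange (Σ⊆ n (f ∘ (true ∷_))) _ _ _)
  where
  interchange : ∀ a b c d → (a + b) + (c + d) ≡ (a + c) + (b + d)
  interchange = solve-∀

length-filter-map : ∀ {A B : Set} {P : Pred B 0ℓ} (P? : Decidable₁ P) (f : A → B) xs →
  length (filter P? (map f xs)) ≡ length (filter (P? ∘ f) xs)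
length-filter-map P? f []       = refl
length-filter-map P? f (x ∷ xs) with does (P? (f x))
... | true  = cong suc (length-filter-map P? f xs)
... | false = length-filter-map P? f xs

length-filter-subsets-suc : ∀ n {P : Pred (Subset (suc n)) 0ℓ} (P? : Decidable₁ P) →
  length (filter P? (subsets (suc n))) ≡
  length (filter (P? ∘ (true ∷_)) (subsets n)) + length (filter (P? ∘ (false ∷_)) (subsets n))
length-filter-subsets-suc n P? = begin
  length (filter P? (map (true ∷_) (subsets n) List.++ map (false ∷_) (subsets n)))
    ≡⟨ cong length (filter-++ P? (map (true ∷_) (subsets n)) _) ⟩
  length (filter P? (map (true ∷_) (subsets n)) List.++ filter P? (map (false ∷_) (subsets n)))
    ≡⟨ length-++ (filter P? (map (true ∷_) (subsets n))) ⟩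
  length (filter P? (map (true ∷_) (subsets n))) + length (filter P? (map (false ∷_) (subsets n)))
    ≡⟨ cong₂ _+_ (length-filter-map P? (true ∷_) (subsets n)) (length-filter-map P? (false ∷_) (subsets n)) ⟩
  length (filter (P? ∘ (true ∷_)) (subsets n)) + length (filter (P? ∘ (false ∷_)) (subsets n)) ∎
  where open ≡-Reasoning

length-filter-subsets : ∀ n {P : Pred (Subset n) 0ℓ} (P? : Decidable₁ P) {f} →
  (∀ x → P x → f x ≡ 1) → (∀ x → ¬ P x → f x ≡ 0) →
  length (filter P? (subsets n)) ≡ Σ⊆ n f
length-filter-subsets zero P? f-yes f-no with P? []
... | yes p = sym (f-yes [] p)
... | no ¬p = sym (f-no [] ¬p)
length-filter-subsets (suc n) P? f-yes f-no = trans (length-filter-subsets-suc n P?) (cong₂ _+_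
  (length-filter-subsets n (P? ∘ (true ∷_)) (f-yes ∘ (true ∷_)) (f-no ∘ (true ∷_)))
  (length-filter-subsets n (P? ∘ (false ∷_)) (f-yes ∘ (false ∷_)) (f-no ∘ (false ∷_))))

length-filter-subsets-++ : ∀ m n {P : Pred (Subset (m + n)) 0ℓ} (P? : Decidable₁ P) {f : Subset m → Subset n → ℕ} →
  (∀ x y → P (x ++ y) → f x y ≡ 1) → (∀ x y → ¬ P (x ++ y) → f x y ≡ 0) →
  length (filter P? (subsets (m + n))) ≡ Σ⊆ m λ x → Σ⊆ n (f x)
length-filter-subsets-++ zero    n P? f-yes f-no = length-filter-subsets n P? (f-yes []) (f-no [])
length-filter-subsets-++ (suc m) n P? f-yes f-no = trans (length-filter-subsets-suc (m + n) P?) (cong₂ _+_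
  (length-filter-subsets-++ m n (P? ∘ (true ∷_)) (f-yes ∘ (true ∷_)) (f-no ∘ (true ∷_)))
  (length-filter-subsets-++ m n (P? ∘ (false ∷_)) (f-yes ∘ (false ∷_)) (f-no ∘ (false ∷_))))

δ : Maybe Bool → Bool → ℕ
δ (just false) false = 1
δ (just true)  true  = 1
δ _            _     = 0

-- The entry at `(c, d)` of the product of the transfer matrices along `R`.
Count : ∀ {n} → Bool → Bool → Subset n → ℕ
Count {n} c d R = Σ⊆ n λ x → Σ⊆ n λ y → δ (run c R x y) d

-- The right side is the trace. A forest closes up from exactly one of the two starting states, any
-- other subgraph from neither.
𝓕-wheel : ∀ {N} (3≤N : 3 ≤ N) (R : Subset N) {a} → lookup R a ≡ true →
  𝓕 (wheel N 3≤N) (hub∪ R) ≡ Count false false R + Count true true R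
𝓕-wheel {N} 3≤N R Ra = begin
  𝓕 (wheel N 3≤N) (hub∪ R)
    ≡⟨ length-filter-subsets-++ N N (λ H → isRootedForest? (wheel N 3≤N) H (hub∪ R)) forest⇒1 ¬forest⇒0 ⟩
  Σ⊆ N (λ x → Σ⊆ N λ y → δ (run false R x y) false + δ (run true R x y) true)
    ≡⟨ Σ⊆-cong N (λ x → Σ⊆-+ N (λ y → δ (run false R x y) false) (λ y → δ (run true R x y) true)) ⟩
  Σ⊆ N (λ x → Σ⊆ N (λ y → δ (run false R x y) false) + Σ⊆ N (λ y → δ (run true R x y) true))
    ≡⟨ Σ⊆-+ N _ _ ⟩
  Count false false R + Count true true R ∎
  where
  open ≡-Reasoning

  δ-≡ : ∀ {m d} → m ≡ just d → δ m d ≡ 1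
  δ-≡ {d = false} refl = refl
  δ-≡ {d = true}  refl = refl

  δ-≢ : ∀ {m} d → m ≢ just d → δ m d ≡ 0
  δ-≢ {nothing}    d     p = refl
  δ-≢ {just false} false p = ⊥-elim (p refl)
  δ-≢ {just false} true  p = refl
  δ-≢ {just true}  false p = refl
  δ-≢ {just true}  true  p = ⊥-elim (p refl)

  exclusive : ∀ x y → run false R x y ≡ just false → run true R x y ≢ just true
  exclusive x y p q with () ← run-deterministic R x y Ra p q

  forest⇒1 : ∀ x y → IsRootedForest (wheel N 3≤N) (x ++ y) (hub∪ R) →
    δ (run false R x y) false + δ (run true R x y) true ≡ 1
  forest⇒1 x y forest with labelling⇒run 3≤N R x y (rootedForest⇒labelling 3≤N R x y forest)
  ... | false , p = cong₂ _+_ (δ-≡ p) (δ-≢ true (exclusive x y p))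
  ... | true  , p = cong₂ _+_ (δ-≢ false (λ q → exclusive x y q p)) (δ-≡ p)

  ¬forest⇒0 : ∀ x y → ¬ IsRootedForest (wheel N 3≤N) (x ++ y) (hub∪ R) →
    δ (run false R x y) false + δ (run true R x y) true ≡ 0
  ¬forest⇒0 x y ¬forest = cong₂ _+_ (δ-≢ false ¬run) (δ-≢ true ¬run)
    where
    ¬run : ∀ {c} → run c R x y ≢ just c
    ¬run p = ¬forest
      (labelling⇒rootedForest 3≤N R x y (proj₂ (run⇒labelling 3≤N R x y p)) Ra)

CountFrom : ∀ {n} → Maybe Bool → Bool → Subset n → ℕ
CountFrom nothing  d R = 0
CountFrom (just c) d R = Count c d R

Count-∷ : ∀ {n} c d ρ (R : Subset n) → Count c d (ρ ∷ R) ≡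
  (CountFrom (step c ρ true  true) d R + CountFrom (step c ρ true  false) d R) +
  (CountFrom (step c ρ false true) d R + CountFrom (step c ρ false false) d R)
Count-∷ {n} c d ρ R = cong₂ _+_ (half true) (half false)
  where
  branch : ∀ a b → Σ⊆ n (λ x → Σ⊆ n λ y → δ (step c ρ a b >>= λ e → run e R x y) d) ≡
    CountFrom (step c ρ a b) d R
  branch a b with step c ρ a b
  ... | nothing = trans (Σ⊆-cong n (λ _ → Σ⊆-zero n)) (Σ⊆-zero n)
  ... | just _  = refl

  half : ∀ a → Σ⊆ n (λ x → Σ⊆ (suc n) λ y → δ (run c (ρ ∷ R) (a ∷ x) y) d) ≡
    CountFrom (step c ρ a true) d R + CountFrom (step c ρ a false) d R
  half a = trans (Σ⊆-+ n _ _) (cong₂ _+_ (branch a true) (branch a false))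

-- Cyclic intervals by recursion along the rim

-- `t` is the distance from the last root to the current position, and `f` the number of rim
-- vertices before the first root, which the last interval picks up when it wraps around.
gapsFrom : ∀ {n} → ℕ → Subset n → ℕ → List ℕ
gapsFrom t []          f = t + f ∷ []
gapsFrom t (true  ∷ R) f = t ∷ gapsFrom 1 R f
gapsFrom t (false ∷ R) f = gapsFrom (suc t) R f

gaps : ∀ {n} → ℕ → Subset n → List ℕ
gaps f []          = []
gaps f (true  ∷ R) = gapsFrom 1 R f
gaps f (false ∷ R) = gaps (suc f) R

positions : ∀ {n} → ℕ → Subset n → List ℕ
positions k []          = []
positions k (true  ∷ R) = k ∷ positions (suc k) R
positions k (false ∷ R) = positions (suc k) R

map-filter-∈ : ∀ {n} k (R : Subset n) →
  map (λ i → k + toℕ i) (filter (_∈? R) (allFin n)) ≡ positions k R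
map-filter-∈ k [] = refl
map-filter-∈ {suc n} k (b ∷ R) = go b
  where
  filter-suc : ∀ b xs → filter (_∈? (b ∷ R)) (map suc xs) ≡ map suc (filter (_∈? R) xs)
  filter-suc b []       = refl
  filter-suc b (x ∷ xs) with does (x ∈? R)
  ... | true  = cong (suc x ∷_) (filter-suc b xs)
  ... | false = filter-suc b xs

  tail : ∀ b → map (λ i → k + toℕ i) (filter (_∈? (b ∷ R)) (List.tabulate suc)) ≡ positions (suc k) R
  tail b = begin
    map (λ i → k + toℕ i) (filter (_∈? (b ∷ R)) (List.tabulate suc))
      ≡⟨ cong (map (λ i → k + toℕ i) ∘ filter (_∈? (b ∷ R))) (map-tabulate id suc) ⟨
    map (λ i → k + toℕ i) (filter (_∈? (b ∷ R)) (map suc (allFin n)))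
      ≡⟨ cong (map (λ i → k + toℕ i)) (filter-suc b (allFin n)) ⟩
    map (λ i → k + toℕ i) (map suc (filter (_∈? R) (allFin n)))
      ≡⟨ map-∘ (filter (_∈? R) (allFin n)) ⟨
    map (λ i → k + suc (toℕ i)) (filter (_∈? R) (allFin n))
      ≡⟨ map-cong (λ i → +-suc k (toℕ i)) (filter (_∈? R) (allFin n)) ⟩
    map (λ i → suc k + toℕ i) (filter (_∈? R) (allFin n))
      ≡⟨ map-filter-∈ (suc k) R ⟩
    positions (suc k) R ∎
    where open ≡-Reasoning

  go : ∀ b → map (λ i → k + toℕ i) (filter (_∈? (b ∷ R)) (allFin (suc n))) ≡ positions k (b ∷ R)
  go true  = cong₂ _∷_ (+-identityʳ k) (tail true)
  go false = tail false

-- Here `a` is the last root passed, `k` the current position, and `e` the first root moved on by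
-- one full turn.
zipWith-positions : ∀ {n} a t f {k e} (R : Subset n) → k ≡ a + t → e ≡ k + n + f →
  zipWith _∸_ (positions k R ∷ʳ e) (a ∷ positions k R) ≡ gapsFrom t R f
zipWith-positions a t f [] refl refl = cong (_∷ []) (begin
  a + t + 0 + f ∸ a   ≡⟨ cong (_∸ a) (shuffle a t f) ⟩
  a + (t + f) ∸ a     ≡⟨ m+n∸m≡n a (t + f) ⟩
  t + f               ∎)
  where
  open ≡-Reasoning
  shuffle : ∀ a t f → a + t + 0 + f ≡ a + (t + f)
  shuffle = solve-∀
zipWith-positions {suc n} a t f {k} (true ∷ R) refl refl = cong₂ _∷_ (m+n∸m≡n a t)
  (zipWith-positions k 1 f R (+-comm 1 k) (cong (_+ f) (+-suc k n)))
zipWith-positions {suc n} a t f {k} (false ∷ R) refl refl =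
  zipWith-positions a (suc t) f R (sym (+-suc a t)) (cong (_+ f) (+-suc k n))

cyclicGaps-positions : ∀ {n} f (R : Subset n) → cyclicGaps (f + n) (positions (suc f) R) ≡ gaps f R
cyclicGaps-positions f [] = refl
cyclicGaps-positions {suc n} f (true ∷ R) =
  zipWith-positions (suc f) 1 f R (+-comm 1 (suc f)) (shuffle f n)
  where
  shuffle : ∀ f n → suc f + (f + suc n) ≡ suc (suc f) + n + f
  shuffle = solve-∀
cyclicGaps-positions {suc n} f (false ∷ R) =
  trans (cong (λ N → cyclicGaps N (positions (2 + f) R)) (+-suc f n)) (cyclicGaps-positions (suc f) R)

cyclicIntervals≡gaps : ∀ {N} (R : Subset N) → cyclicIntervals R ≡ gaps 0 R
cyclicIntervals≡gaps {N} R =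
  trans (cong (cyclicGaps N) (map-filter-∈ 1 R)) (cyclicGaps-positions 0 R)

sum-gapsFrom : ∀ {n} t (R : Subset n) f → sum (gapsFrom t R f) ≡ t + n + f
sum-gapsFrom t [] f = shuffle t f
  where
  shuffle : ∀ t f → t + f + 0 ≡ t + 0 + f
  shuffle = solve-∀
sum-gapsFrom {suc n} t (true ∷ R) f =
  trans (cong (t +_) (sum-gapsFrom 1 R f)) (sym (+-assoc t (suc n) f))
sum-gapsFrom {suc n} t (false ∷ R) f =
  trans (sum-gapsFrom (suc t) R f) (cong (_+ f) (sym (+-suc t n)))

sum-gaps : ∀ {n} f (R : Subset n) {a} → lookup R a ≡ true → sum (gaps f R) ≡ f + n
sum-gaps {suc n} f (true  ∷ R) _ = trans (sum-gapsFrom 1 R f) (+-comm (suc n) f)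
sum-gaps {suc n} f (false ∷ R) {suc a} Ra = trans (sum-gaps (suc f) R Ra) (sym (+-suc f n))

length-gapsFrom : ∀ {n} t (R : Subset n) f → length (gapsFrom t R f) ≡ suc ∣ R ∣
length-gapsFrom t []          f = refl
length-gapsFrom t (true  ∷ R) f = cong suc (length-gapsFrom 1 R f)
length-gapsFrom t (false ∷ R) f = length-gapsFrom (suc t) R f

length-gaps : ∀ {n} f (R : Subset n) → length (gaps f R) ≡ ∣ R ∣
length-gaps f []          = refl
length-gaps f (true  ∷ R) = length-gapsFrom 1 R f
length-gaps f (false ∷ R) = length-gaps (suc f) R

gapsFrom-positive : ∀ {n} t (R : Subset n) f → All (1 ≤_) (gapsFrom (suc t) R f)
gapsFrom-positive t []          f = z<s ∷ []
gapsFrom-positive t (true  ∷ R) f = z<s ∷ gapsFrom-positive 0 R f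
gapsFrom-positive t (false ∷ R) f = gapsFrom-positive (suc t) R f

gaps-positive : ∀ {n} f (R : Subset n) → All (1 ≤_) (gaps f R)
gaps-positive f []          = []
gaps-positive f (true  ∷ R) = gapsFrom-positive 0 R f
gaps-positive f (false ∷ R) = gaps-positive (suc f) R

nonempty : ∀ {n} (R : Subset n) → 1 ≤ ∣ R ∣ → ∃[ a ] lookup R a ≡ true
nonempty (true  ∷ R) _ = zero , refl
nonempty (false ∷ R) p with a , Ra ← nonempty R p = suc a , Ra

-- Intervals enter as predecessors, so any list is admissible: each block is a root followed by `e`
-- other vertices.
withGaps : ∀ es → Subset (sum (map suc es))
withGaps []       = []
withGaps (e ∷ es) = true ∷ (Vec.replicate e false ++ withGaps es)

gapsFrom-replicate : ∀ e {n} t (R : Subset n) f →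
  gapsFrom t (Vec.replicate e false ++ R) f ≡ gapsFrom (t + e) R f
gapsFrom-replicate zero    t R f = cong (λ t → gapsFrom t R f) (sym (+-identityʳ t))
gapsFrom-replicate (suc e) t R f =
  trans (gapsFrom-replicate e (suc t) R f) (cong (λ t → gapsFrom t R f) (sym (+-suc t e)))

gapsFrom-withGaps : ∀ t es → gapsFrom t (withGaps es) 0 ≡ t ∷ map suc es
gapsFrom-withGaps t []       = cong (_∷ []) (+-identityʳ t)
gapsFrom-withGaps t (e ∷ es) = cong (t ∷_)
  (trans (gapsFrom-replicate e 1 (withGaps es) 0) (gapsFrom-withGaps (suc e) es))

gaps-withGaps : ∀ e es → gaps 0 (withGaps (e ∷ es)) ≡ map suc (e ∷ es)
gaps-withGaps e es =
  trans (gapsFrom-replicate e 1 (withGaps es) 0) (gapsFrom-withGaps (suc e) es)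

-- Fibonacci numbers and the transfer matrices

fib₂ : ℕ → ℕ
fib₂ d = fib (2 * d)

fib-even : ∀ t → fib (2 * suc t) ≡ fib (suc (2 * t)) + fib (2 * t)
fib-even t = cong fib (*-suc 2 t)

fib-odd : ∀ t → fib (suc (2 * suc t)) ≡ fib (2 * suc t) + fib (suc (2 * t))
fib-odd t = cong (λ k → fib (2 * suc t) + fib k) (+-suc t (t + 0))

fib-+ : ∀ m n → fib (suc m + n) ≡ fib (suc m) * fib (suc n) + fib m * fib n
fib-+ zero    n = sym (trans (+-identityʳ _) (*-identityˡ _))
fib-+ (suc m) n = begin
  fib (suc (suc m) + n)                                     ≡⟨ cong fib (+-suc (suc m) n) ⟨
  fib (suc m + suc n)                                       ≡⟨ fib-+ m (suc n) ⟩
  fib (suc m) * (fib (suc n) + fib n) + fib m * fib (suc n)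
    ≡⟨ regroup (fib (suc m)) (fib m) (fib (suc n)) (fib n) ⟩
  (fib (suc m) + fib m) * fib (suc n) + fib (suc m) * fib n ∎
  where
  open ≡-Reasoning
  regroup : ∀ a b c d → a * (c + d) + b * c ≡ (a + b) * c + a * d
  regroup = solve-∀

Πfib₂ : List ℕ → ℕ
Πfib₂ = product ∘ map fib₂

Count-true : ∀ {n} d (R : Subset n) →
  Count false d (true ∷ R) ≡ Count false d R + Count true d R × Count true d (true ∷ R) ≡ 0
Count-true d R = trans (Count-∷ false d true R) (+-comm (Count true d R) _) , Count-∷ true d true R

Count-false : ∀ {n} d (R : Subset n) →
  Count false d (false ∷ R) ≡ 2 * Count false d R + Count true d R ×
  Count true d (false ∷ R) ≡ Count false d R + Count true d R
Count-false d R =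
  trans (Count-∷ false d false R) (regroup (Count true d R) (Count false d R)) ,
  trans (Count-∷ true d false R) (+-comm (Count true d R) _)
  where
  regroup : ∀ a b → (a + b) + (b + 0) ≡ 2 * b + a
  regroup = solve-∀

-- The row vector `(c e)` times column `d` of the matrix `Count`. Pushing the vector through one
-- vertex at a time avoids matrix algebra.
weighted : ∀ {n} → ℕ → ℕ → Bool → Subset n → ℕ
weighted c e d R = c * Count false d R + e * Count true d R

-- A root has the matrix with rows (1 1) and (0 0): it splits off the scalar `c` and resets the
-- vector to (1 1). This is where the trace factorises.
weighted-true : ∀ {n} c e d (R : Subset n) →
  weighted c e d (true ∷ R) ≡
  c * weighted 1 1 d R
weighted-true c e d R with p , q ← Count-true d R = trans (cong₂ (λ u v → c * u + e * v) p q)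
  (regroup c e (Count false d R) (Count true d R))
  where
  regroup : ∀ c e x y → c * (x + y) + e * 0 ≡ c * (1 * x + 1 * y)
  regroup = solve-∀

weighted-false : ∀ {n} c e d (R : Subset n) →
  weighted c e d (false ∷ R) ≡
  weighted ((c + e) + c) (c + e) d R
weighted-false c e d R with p , q ← Count-false d R = trans (cong₂ (λ u v → c * u + e * v) p q)
  (regroup c e (Count false d R) (Count true d R))
  where
  regroup : ∀ c e x y → c * (2 * x + y) + e * (x + y) ≡ ((c + e) + c) * x + (c + e) * y
  regroup = solve-∀

-- With M = (2 1; 1 1), the weights `c`, `e` form the row (1 1) M^t collected since the last root.
-- The outer factors form the first column of M^f, left over from the vertices before the first
-- root. At the end of the rim the two meet, and the addition formula turns them into the wrapped
-- interval.
Count-gapsFrom : ∀ {n} t f (R : Subset n) →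
  let c = fib (2 * suc t) ; e = fib (suc (2 * t)) in
  fib (suc (2 * f)) * weighted c e false R +
  fib (2 * f)       * weighted c e true R
  ≡ Πfib₂ (gapsFrom (suc t) R f)
Count-gapsFrom t f [] = begin
  o f * (g (suc t) * 1 + o t * 0) + g f * (g (suc t) * 0 + o t * 1)
    ≡⟨ simplify (o f) (g f) (g (suc t)) (o t) ⟩
  (o f * g (suc t) + g f * o t) * 1                        ≡⟨ cong (λ k → (o f * fib k + g f * o t) * 1) (*-suc 2 t) ⟩
  (o f * fib (2 + 2 * t) + g f * o t) * 1                  ≡⟨ cong (_* 1) (fib-+ (2 * f) (suc (2 * t))) ⟨
  fib (suc (2 * f) + suc (2 * t)) * 1                      ≡⟨ cong (λ k → fib k * 1) (index t f) ⟩
  fib (2 * (suc t + f)) * 1                                ∎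
  where
  open ≡-Reasoning
  g o : ℕ → ℕ
  g t = fib (2 * t)
  o t = fib (suc (2 * t))
  simplify : ∀ a b c d → a * (c * 1 + d * 0) + b * (c * 0 + d * 1) ≡ (a * c + b * d) * 1
  simplify = solve-∀
  index : ∀ t f → suc (2 * f) + suc (2 * t) ≡ 2 * (suc t + f)
  index = solve-∀
Count-gapsFrom t f (true ∷ R) = begin
  a * weighted c e false (true ∷ R) + b * weighted c e true (true ∷ R)
    ≡⟨ cong₂ (λ u v → a * u + b * v) (weighted-true c e false R) (weighted-true c e true R) ⟩
  a * (c * weighted 1 1 false R) + b * (c * weighted 1 1 true R)
    ≡⟨ factor a b c (weighted 1 1 false R) (weighted 1 1 true R) ⟩
  c * (a * weighted 1 1 false R + b * weighted 1 1 true R)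
    ≡⟨ cong (c *_) (Count-gapsFrom 0 f R) ⟩
  Πfib₂ (gapsFrom (suc t) (true ∷ R) f) ∎
  where
  open ≡-Reasoning
  a = fib (suc (2 * f))
  b = fib (2 * f)
  c = fib (2 * suc t)
  e = fib (suc (2 * t))
  factor : ∀ a b c u v → a * (c * u) + b * (c * v) ≡ c * (a * u + b * v)
  factor = solve-∀
Count-gapsFrom t f (false ∷ R) = begin
  a * weighted c e false (false ∷ R) + b * weighted c e true (false ∷ R)
    ≡⟨ cong₂ (λ u v → a * u + b * v) (weighted-false c e false R) (weighted-false c e true R) ⟩
  a * weighted ((c + e) + c) (c + e) false R + b * weighted ((c + e) + c) (c + e) true R
    ≡⟨ cong₂ (λ c e → a * weighted c e false R + b * weighted c e true R)
         (trans (fib-even (suc t)) (cong (_+ c) (fib-odd t))) (fib-odd t) ⟨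
  a * weighted (fib (2 * suc (suc t))) (fib (suc (2 * suc t))) false R +
  b * weighted (fib (2 * suc (suc t))) (fib (suc (2 * suc t))) true R
    ≡⟨ Count-gapsFrom (suc t) f R ⟩
  Πfib₂ (gapsFrom (suc t) (false ∷ R) f) ∎
  where
  open ≡-Reasoning
  a = fib (suc (2 * f))
  b = fib (2 * f)
  c = fib (2 * suc t)
  e = fib (suc (2 * t))

-- With p = F_{2f−1} (which is 1 for f = 0), the weights are the entries of the f-th power
-- of the transfer matrix (2 1; 1 1), and the left side is a trace.
Count-gaps : ∀ {n} p f (R : Subset n) {a} → lookup R a ≡ true → fib (2 * f) + p ≡ fib (suc (2 * f)) →
  weighted (fib (suc (2 * f))) (fib (2 * f)) false R +
  weighted (fib (2 * f)) p true R
  ≡ Πfib₂ (gaps f R)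
Count-gaps p f (true ∷ R) _ _ = trans
  (cong₂ _+_ (weighted-true (fib (suc (2 * f))) (fib (2 * f)) false R) (weighted-true (fib (2 * f)) p true R))
  (Count-gapsFrom 0 f R)
Count-gaps p f (false ∷ R) {suc _} Ra eq = begin
  weighted a b false (false ∷ R) + weighted b p true (false ∷ R)
    ≡⟨ cong₂ _+_ (weighted-false a b false R) (weighted-false b p true R) ⟩
  weighted ((a + b) + a) (a + b) false R + weighted ((b + p) + b) (b + p) true R
    ≡⟨ cong₂ _+_
         (cong₂ (λ c e → weighted c e false R)
           (trans (cong (_+ a) (sym (fib-even f))) (sym (fib-odd f))) (sym (fib-even f)))
         (cong₂ (λ c e → weighted c e true R)
           (trans (cong (_+ b) eq) (sym (fib-even f))) eq) ⟩
  weighted (fib (suc (2 * suc f))) (fib (2 * suc f)) false R + weighted (fib (2 * suc f)) a true R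
    ≡⟨ Count-gaps a (suc f) R Ra (sym (fib-odd f)) ⟩
  Πfib₂ (gaps f (false ∷ R)) ∎
  where
  open ≡-Reasoning
  a = fib (suc (2 * f))
  b = fib (2 * f)

𝓕-wheel-gaps : ∀ {N} (3≤N : 3 ≤ N) (R : Subset N) → 1 ≤ ∣ R ∣ →
  𝓕 (wheel N 3≤N) (hub∪ R) ≡ Πfib₂ (cyclicIntervals R)
𝓕-wheel-gaps {N} 3≤N R ne = begin
  𝓕 (wheel N 3≤N) (hub∪ R)                ≡⟨ 𝓕-wheel 3≤N R Ra ⟩
  Count false false R + Count true true R
    ≡⟨ pad (Count false false R) (Count true false R) (Count false true R) (Count true true R) ⟩
  weighted 1 0 false R + weighted 0 1 true R     ≡⟨ Count-gaps 1 0 R Ra refl ⟩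
  Πfib₂ (gaps 0 R)                           ≡⟨ cong Πfib₂ (cyclicIntervals≡gaps R) ⟨
  Πfib₂ (cyclicIntervals R)                  ∎
  where
  open ≡-Reasoning
  Ra = proj₂ (nonempty R ne)
  pad : ∀ x₀ x₁ y₀ y₁ → x₀ + y₁ ≡ (1 * x₀ + 0 * x₁) + (0 * y₀ + 1 * y₁)
  pad = solve-∀

-- Inequalities between products of Fibonacci numbers

fib₂-+ : ∀ a b → fib₂ (suc a) * fib₂ (suc b) ≡ fib₂ (suc (a + b)) + fib₂ a * fib₂ b
fib₂-+ a b = begin
  fib₂ (suc a) * fib₂ (suc b)
    ≡⟨ cong₂ _*_ (fib-even a) (fib-even b) ⟩
  (A′ + A) * (B′ + B)
    ≡⟨ expand A A′ B B′ ⟩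
  A′ * (B′ + B) + A * B′ + A * B
    ≡⟨ cong (_+ A * B) (fib-+ (2 * a) (suc (2 * b))) ⟨
  fib (suc (2 * a) + suc (2 * b)) + A * B
    ≡⟨ cong (λ k → fib k + A * B) (index a b) ⟩
  fib₂ (suc (a + b)) + fib₂ a * fib₂ b ∎
  where
  open ≡-Reasoning
  A  = fib (2 * a)
  A′ = fib (suc (2 * a))
  B  = fib (2 * b)
  B′ = fib (suc (2 * b))
  expand : ∀ a a′ b b′ → (a′ + a) * (b′ + b) ≡ a′ * (b′ + b) + a * b′ + a * b
  expand = solve-∀
  index : ∀ a b → suc (2 * a) + suc (2 * b) ≡ 2 * suc (a + b)
  index = solve-∀

-- The characteristic equation of (2 1; 1 1), which has trace 3 and determinant 1.
fib₂-rec : ∀ d → fib₂ (2 + d) + fib₂ d ≡ 3 * fib₂ (suc d)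
fib₂-rec d = begin
  fib₂ (2 + d) + fib₂ d                              ≡⟨ cong (_+ fib₂ d) (fib-even (suc d)) ⟩
  fib (suc (2 * suc d)) + fib₂ (suc d) + fib₂ d      ≡⟨ cong (λ k → k + fib₂ (suc d) + fib₂ d) (fib-odd d) ⟩
  fib₂ (suc d) + fib (suc (2 * d)) + fib₂ (suc d) + fib₂ d
                                                     ≡⟨ regroup (fib₂ (suc d)) (fib (suc (2 * d))) (fib₂ d) ⟩
  fib₂ (suc d) + fib₂ (suc d) + (fib (suc (2 * d)) + fib₂ d)
                                                     ≡⟨ cong (fib₂ (suc d) + fib₂ (suc d) +_) (fib-even d) ⟨
  fib₂ (suc d) + fib₂ (suc d) + fib₂ (suc d)         ≡⟨ triple (fib₂ (suc d)) ⟩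
  3 * fib₂ (suc d)                                   ∎
  where
  open ≡-Reasoning
  regroup : ∀ x y z → x + y + x + z ≡ x + x + (y + z)
  regroup = solve-∀
  triple : ∀ x → x + x + x ≡ 3 * x
  triple = solve-∀

fib-suc>0 : ∀ n → 0 < fib (suc n)
fib-suc>0 zero    = z<s
fib-suc>0 (suc n) = ≤-trans (fib-suc>0 n) (m≤m+n _ _)

fib₂-suc>0 : ∀ d → 0 < fib₂ (suc d)
fib₂-suc>0 d = fib-suc>0 (d + suc (d + 0))

-- `fib₂ (k + q)` and `fib₂ q`, as sequences in `q`, satisfy the same recurrence with determinant 1,
-- so their Casoratian does not depend on `q`; its value `fib₂ k` is read off at `q = 0`.
fib₂-cross : ∀ k q → fib₂ (suc k + q) * fib₂ q + fib₂ k ≡ fib₂ (k + q) * fib₂ (suc q)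
fib₂-cross k zero = begin
  fib₂ (suc k + 0) * 0 + fib₂ k ≡⟨ cong (_+ fib₂ k) (*-zeroʳ (fib₂ (suc k + 0))) ⟩
  fib₂ k                        ≡⟨ cong fib₂ (+-identityʳ k) ⟨
  fib₂ (k + 0)                  ≡⟨ *-identityʳ _ ⟨
  fib₂ (k + 0) * 1              ∎
  where open ≡-Reasoning
-- Adding `y * z`, the right side of the induction hypothesis, lets the recurrence be applied
-- without subtraction.
fib₂-cross k (suc q) = +-cancelʳ-≡ (y * z) _ _ (begin
  fib₂ (suc k + suc q) * z + fib₂ k + y * z ≡⟨ cong (λ m → fib₂ m * z + fib₂ k + y * z) (+-suc (suc k) q) ⟩
  x * z + fib₂ k + y * z                    ≡⟨ collect x y z (fib₂ k) ⟩
  (x + y) * z + fib₂ k                      ≡⟨ cong (λ m → m * z + fib₂ k) (fib₂-rec (k + q)) ⟩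
  3 * w * z + fib₂ k                        ≡⟨ rotate w z (fib₂ k) ⟩
  w * (3 * z) + fib₂ k                      ≡⟨ cong (λ m → w * m + fib₂ k) (fib₂-rec q) ⟨
  w * (fib₂ (2 + q) + fib₂ q) + fib₂ k      ≡⟨ distribute w (fib₂ (2 + q)) (fib₂ q) (fib₂ k) ⟩
  w * fib₂ (2 + q) + (w * fib₂ q + fib₂ k)  ≡⟨ cong (w * fib₂ (2 + q) +_) (fib₂-cross k q) ⟩
  w * fib₂ (2 + q) + y * z                  ≡⟨ cong (λ m → fib₂ m * fib₂ (2 + q) + y * z) (+-suc k q) ⟨
  fib₂ (k + suc q) * fib₂ (2 + q) + y * z   ∎)
  where
  open ≡-Reasoning
  x = fib₂ (2 + (k + q))
  y = fib₂ (k + q)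
  z = fib₂ (suc q)
  w = fib₂ (suc (k + q))
  collect : ∀ x y z u → x * z + u + y * z ≡ (x + y) * z + u
  collect = solve-∀
  rotate : ∀ w z u → 3 * w * z + u ≡ w * (3 * z) + u
  rotate = solve-∀
  distribute : ∀ w a b u → w * (a + b) + u ≡ w * a + (w * b + u)
  distribute = solve-∀

-- By `fib₂-cross` the two sides differ by exactly `fib₂ (q ∸ d)`. The cross-multiplied form also
-- covers `d = 0`, where `fib₂` vanishes.
fib₂-log-concave : ∀ {d q} → d < q → fib₂ (suc q) * fib₂ d < fib₂ q * fib₂ (suc d)
fib₂-log-concave {d} d<q with k , refl ← m≤n⇒∃[o]m+o≡n d<q =
  subst (λ q → fib₂ (suc q) * fib₂ d < fib₂ q * fib₂ (suc d)) (cong suc (+-comm k d))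
    (subst (fib₂ (2 + k + d) * fib₂ d <_) (fib₂-cross (suc k) d) (m<m+n _ (fib₂-suc>0 k)))

-- The minimal product

Πfib₂-↭ : ∀ {xs ys} → xs ↭ ys → Πfib₂ xs ≡ Πfib₂ ys
Πfib₂-↭ p = product-↭ (Perm.map⁺ _ p)

Πfib₂-replicate-1 : ∀ k → Πfib₂ (replicate k 1) ≡ 1
Πfib₂-replicate-1 zero    = refl
Πfib₂-replicate-1 (suc k) = trans (+-identityʳ _) (Πfib₂-replicate-1 k)

Πfib₂-concentrated : ∀ d k → Πfib₂ (d ∷ replicate k 1) ≡ fib₂ d
Πfib₂-concentrated d k = trans (cong (fib₂ d *_) (Πfib₂-replicate-1 k)) (*-identityʳ (fib₂ d))

-- Entries are intervals minus one. The tail is treated first and the head is then merged into it by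
-- `fib₂-+`, whose slack `fib₂ e * fib₂ E` vanishes only if `e` or `E` is zero. In these cases one
-- of the two intervals has length 1 already and the list is a permutation of the extremal one.
Πfib₂-min : ∀ e es → let E = sum (e ∷ es) in
  map suc (e ∷ es) ↭ suc E ∷ replicate (length es) 1 ⊎ fib₂ (suc E) < Πfib₂ (map suc (e ∷ es))
Πfib₂-min e [] = inj₁ (subst (λ k → suc e ∷ [] ↭ suc k ∷ []) (sym (+-identityʳ e)) ↭-refl)
Πfib₂-min e es@(e′ ∷ es′) with Πfib₂-min e′ es′
... | inj₂ lt = inj₂ (begin-strict
  fib₂ (suc (e + sum es))                     ≤⟨ m≤m+n _ _ ⟩
  fib₂ (suc (e + sum es)) + fib₂ e * fib₂ (sum es) ≡⟨ fib₂-+ e (sum es) ⟨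
  fib₂ (suc e) * fib₂ (suc (sum es))          <⟨ *-monoʳ-< _ {{>-nonZero (fib₂-suc>0 e)}} lt ⟩
  fib₂ (suc e) * Πfib₂ (map suc es)              ∎)
  where open ≤-Reasoning
... | inj₁ p = go e (sum es) p
  where
  go : ∀ e E → map suc es ↭ suc E ∷ replicate (length es′) 1 →
    suc e ∷ map suc es ↭ suc (e + E) ∷ replicate (length es) 1 ⊎
    fib₂ (suc (e + E)) < Πfib₂ (suc e ∷ map suc es)
  go zero    E       p = inj₁ (↭-trans (↭-prep 1 p) (↭-swap 1 (suc E) ↭-refl))
  go (suc e) zero    p = inj₁ (subst (λ k → suc (suc e) ∷ map suc es ↭ suc k ∷ replicate (length es) 1)
    (sym (+-identityʳ (suc e))) (↭-prep (2 + e) p))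
  go e@(suc a) E@(suc b) p = inj₂ (begin-strict
    fib₂ (suc (e + E))                   <⟨ m<m+n _ (*-mono-≤ (fib₂-suc>0 a) (fib₂-suc>0 b)) ⟩
    fib₂ (suc (e + E)) + fib₂ e * fib₂ E ≡⟨ fib₂-+ e E ⟨
    fib₂ (suc e) * fib₂ (suc E)          ≡⟨ cong (fib₂ (suc e) *_) (Πfib₂-concentrated (suc E) (length es′)) ⟨
    fib₂ (suc e) * Πfib₂ (suc E ∷ replicate (length es′) 1) ≡⟨ cong (fib₂ (suc e) *_) (Πfib₂-↭ p) ⟨
    fib₂ (suc e) * Πfib₂ (map suc es)       ∎)
    where open ≤-Reasoning

-- The maximal product

occurrences-hit : ∀ x xs → occurrences x (x ∷ xs) ≡ suc (occurrences x xs)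
occurrences-hit x xs = cong length (filter-accept (x ≟_) {xs = xs} refl)

occurrences-miss : ∀ {x y} xs → x ≢ y → occurrences x (y ∷ xs) ≡ occurrences x xs
occurrences-miss {x} xs x≢y = cong length (filter-reject (x ≟_) {xs = xs} x≢y)

module _ (q : ℕ) (1≤q : 1 ≤ q) where

  Near : ℕ → Set
  Near d = d ≡ q ⊎ d ≡ suc q

  private
    a b : ℕ
    a = fib₂ q
    b = fib₂ (suc q)

    fib₂>0 : ∀ {d} → 1 ≤ d → 0 < fib₂ d
    fib₂>0 (s≤s {n = d} _) = fib₂-suc>0 d

    instance
      a≢0 : NonZero a
      a≢0 = >-nonZero (fib₂>0 1≤q)
      b≢0 : NonZero b
      b≢0 = >-nonZero (fib₂-suc>0 q)

    -- A multiplicative tangent line: log fib₂ is concave, and lhs d ≤ rhs d bounds it by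
    -- the line through its values at q and q + 1, cleared of denominators.
    lhs rhs : ℕ → ℕ
    lhs d = fib₂ d * (b ^ q * a ^ d)
    rhs d = a ^ suc q * b ^ d

    rhs>0 : ∀ d → 0 < rhs d
    rhs>0 d = *-mono-≤ (m^n>0 a (suc q)) (m^n>0 b d)

    near⇒≡ : ∀ {d} → Near d → lhs d ≡ rhs d
    near⇒≡ (inj₁ refl) = regroup a (b ^ q) (a ^ q)
      where
      regroup : ∀ a B A → a * (B * A) ≡ (a * A) * B
      regroup = solve-∀
    near⇒≡ (inj₂ refl) = regroup a b (b ^ q) (a ^ q)
      where
      regroup : ∀ a b B A → b * (B * (a * A)) ≡ (a * A) * (b * B)
      regroup = solve-∀

    -- Passing from `d` to `suc d` multiplies `rhs` by `b` and `lhs` by `a` times the ratio of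
    -- consecutive `fib₂`; beyond `q` that ratio is below `b / a`.
    step-up : ∀ {d} → q < d → lhs d ≤ rhs d → lhs (suc d) < rhs (suc d)
    step-up {d} q<d le = begin-strict
      fib₂ (suc d) * (b ^ q * (a * a ^ d))  ≡⟨ front (fib₂ (suc d)) a (b ^ q) (a ^ d) ⟩
      (fib₂ (suc d) * a) * (b ^ q * a ^ d)
        <⟨ *-monoˡ-< _ {{m*n≢0 (b ^ q) (a ^ d) {{m^n≢0 b q}} {{m^n≢0 a d}}}} (fib₂-log-concave q<d) ⟩
      (fib₂ d * b) * (b ^ q * a ^ d)        ≡⟨ back (fib₂ d) b _ ⟩
      b * lhs d                             ≤⟨ *-monoʳ-≤ b le ⟩
      b * rhs d                             ≡⟨ swap-* b (a ^ suc q) (b ^ d) ⟩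
      rhs (suc d)                           ∎
      where
      open ≤-Reasoning
      front : ∀ f a B A → f * (B * (a * A)) ≡ (f * a) * (B * A)
      front = solve-∀
      back : ∀ f b X → (f * b) * X ≡ b * (f * X)
      back = solve-∀
      swap-* : ∀ b A B → b * (A * B) ≡ A * (b * B)
      swap-* = solve-∀

    step-down : ∀ {d} → d < q → lhs (suc d) ≤ rhs (suc d) → lhs d < rhs d
    -- Going down removes a factor `a` on the left and `b` on the right; multiplying by `a * b`
    -- clears both divisions.
    step-down {d} d<q le = *-cancelˡ-< (a * b) _ _ (begin-strict
      a * b * lhs d                             ≡⟨ front a b (fib₂ d) (b ^ q) (a ^ d) ⟩
      (b * fib₂ d) * (b ^ q * (a * a ^ d))
        <⟨ *-monoˡ-< _ {{m*n≢0 (b ^ q) (a ^ suc d) {{m^n≢0 b q}} {{m^n≢0 a (suc d)}}}} (fib₂-log-concave d<q) ⟩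
      (a * fib₂ (suc d)) * (b ^ q * (a * a ^ d)) ≡⟨ *-assoc a (fib₂ (suc d)) _ ⟩
      a * lhs (suc d)                           ≤⟨ *-monoʳ-≤ a le ⟩
      a * rhs (suc d)                           ≡⟨ back a b (a ^ suc q) (b ^ d) ⟩
      a * b * rhs d                             ∎)
      where
      open ≤-Reasoning
      front : ∀ a b f B A → a * b * (f * (B * A)) ≡ (b * f) * (B * (a * A))
      front = solve-∀
      back : ∀ a b A B → a * (A * (b * B)) ≡ a * b * (A * B)
      back = solve-∀

    above-≤ : ∀ k → lhs (suc k + q) ≤ rhs (suc k + q)
    above-≤ zero    = ≤-reflexive (near⇒≡ (inj₂ refl))
    above-≤ (suc k) = <⇒≤ (step-up (s≤s (m≤n+m q k)) (above-≤ k))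

    below-≤ : ∀ k {d} → k + d ≡ q → lhs d ≤ rhs d
    below-≤ zero    refl = ≤-reflexive (near⇒≡ (inj₁ refl))
    below-≤ (suc k) {d} e = <⇒≤ (step-down (subst (d <_) e (s≤s (m≤n+m d k)))
      (below-≤ k (trans (+-suc k d) e)))

    near⊎< : ∀ d → Near d ⊎ lhs d < rhs d
    near⊎< d with <-cmp d q
    ... | tri≈ _ d≡q _ = inj₁ (inj₁ d≡q)
    ... | tri< d<q _ _ = inj₂ (step-down d<q
      (below-≤ (q ∸ suc d) (m∸n+n≡m d<q)))
    -- The range above `q` still contains the second point of contact, `suc q`.
    ... | tri> _ _ q<d with d ∸ suc q | m∸n+n≡m q<d
    ...   | zero  | e    = inj₁ (inj₂ (sym e))
    ...   | suc k | refl = inj₂ (subst (λ d → lhs d < rhs d) (cong suc (sym (+-suc k q)))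
      (step-up (s≤s (m≤n+m q k)) (above-≤ k)))

    Πlhs Πrhs : List ℕ → ℕ
    Πlhs = product ∘ map lhs
    Πrhs = product ∘ map rhs

    Πrhs>0 : ∀ ds → 0 < Πrhs ds
    Πrhs>0 []       = z<s
    Πrhs>0 (d ∷ ds) = *-mono-≤ (rhs>0 d) (Πrhs>0 ds)

    all-near⇒≡ : ∀ {ds} → All Near ds → Πlhs ds ≡ Πrhs ds
    all-near⇒≡ []       = refl
    all-near⇒≡ (p ∷ ps) = cong₂ _*_ (near⇒≡ p) (all-near⇒≡ ps)

    lhs≤rhs : ∀ d → lhs d ≤ rhs d
    lhs≤rhs d = [ ≤-reflexive ∘ near⇒≡ , <⇒≤ ]′ (near⊎< d)

    Πlhs≤Πrhs : ∀ ds → Πlhs ds ≤ Πrhs ds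
    Πlhs≤Πrhs []       = ≤-refl
    Πlhs≤Πrhs (d ∷ ds) = *-mono-≤ (lhs≤rhs d) (Πlhs≤Πrhs ds)

    all-near⊎< : ∀ ds → All Near ds ⊎ Πlhs ds < Πrhs ds
    all-near⊎< []       = inj₁ []
    all-near⊎< (d ∷ ds) with near⊎< d | all-near⊎< ds
    ... | inj₁ p  | inj₁ ps = inj₁ (p ∷ ps)
    ... | inj₂ lt | _       = inj₂ (≤-<-trans (*-monoʳ-≤ (lhs d) (Πlhs≤Πrhs ds))
      (*-monoˡ-< (Πrhs ds) {{>-nonZero (Πrhs>0 ds)}} lt))
    ... | inj₁ _  | inj₂ lt = inj₂ (≤-<-trans (*-monoˡ-≤ (Πlhs ds) (lhs≤rhs d))
      (*-monoʳ-< (rhs d) {{>-nonZero (rhs>0 d)}} lt))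

    -- Apart from `Πfib₂ ds`, the products of `lhs` and of `rhs` depend only on the length and the
    -- sum. With both fixed, the pointwise bounds compare `Πfib₂ ds` with a constant.
    Πlhs-Πfib₂ : ∀ ds → Πlhs ds ≡ Πfib₂ ds * ((b ^ q) ^ length ds * a ^ sum ds)
    Πlhs-Πfib₂ []       = refl
    Πlhs-Πfib₂ (d ∷ ds) = begin
      fib₂ d * (b ^ q * a ^ d) * Πlhs ds
        ≡⟨ cong (lhs d *_) (Πlhs-Πfib₂ ds) ⟩
      fib₂ d * (b ^ q * a ^ d) * (Πfib₂ ds * ((b ^ q) ^ length ds * a ^ sum ds))
        ≡⟨ regroup (fib₂ d) (b ^ q) (a ^ d) (Πfib₂ ds) ((b ^ q) ^ length ds) (a ^ sum ds) ⟩
      fib₂ d * Πfib₂ ds * (b ^ q * (b ^ q) ^ length ds * (a ^ d * a ^ sum ds))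
        ≡⟨ cong (λ k → fib₂ d * Πfib₂ ds * ((b ^ q) ^ suc (length ds) * k)) (^-distribˡ-+-* a d (sum ds)) ⟨
      fib₂ d * Πfib₂ ds * ((b ^ q) ^ suc (length ds) * a ^ (d + sum ds)) ∎
      where
      open ≡-Reasoning
      regroup : ∀ f B A F B′ A′ → f * (B * A) * (F * (B′ * A′)) ≡ f * F * (B * B′ * (A * A′))
      regroup = solve-∀

    Πrhs-^ : ∀ ds → Πrhs ds ≡ (a ^ suc q) ^ length ds * b ^ sum ds
    Πrhs-^ []       = refl
    Πrhs-^ (d ∷ ds) = begin
      a ^ suc q * b ^ d * Πrhs ds
        ≡⟨ cong (rhs d *_) (Πrhs-^ ds) ⟩
      a ^ suc q * b ^ d * ((a ^ suc q) ^ length ds * b ^ sum ds)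
        ≡⟨ regroup (a ^ suc q) (b ^ d) ((a ^ suc q) ^ length ds) (b ^ sum ds) ⟩
      a ^ suc q * (a ^ suc q) ^ length ds * (b ^ d * b ^ sum ds)
        ≡⟨ cong ((a ^ suc q) ^ suc (length ds) *_) (^-distribˡ-+-* b d (sum ds)) ⟨
      (a ^ suc q) ^ suc (length ds) * b ^ (d + sum ds) ∎
      where
      open ≡-Reasoning
      regroup : ∀ A B A′ B′ → A * B * (A′ * B′) ≡ A * A′ * (B * B′)
      regroup = solve-∀

  module _ {r s : ℕ} (s≤r : s ≤ r) (ds : List ℕ)
    (length-ds : length ds ≡ r) (sum-ds : sum ds ≡ q * r + s) where

    private
      scale : ℕ
      scale = (b ^ q) ^ r * a ^ (q * r + s)

      scale≢0 : NonZero scale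
      scale≢0 = m*n≢0 _ _ {{m^n≢0 (b ^ q) r {{m^n≢0 b q}}}} {{m^n≢0 a (q * r + s)}}

      Πlhs-scale : Πlhs ds ≡ Πfib₂ ds * scale
      Πlhs-scale = trans (Πlhs-Πfib₂ ds)
        (cong₂ (λ r N → Πfib₂ ds * ((b ^ q) ^ r * a ^ N)) length-ds sum-ds)

      Πrhs-scale : Πrhs ds ≡ b ^ s * a ^ (r ∸ s) * scale
      Πrhs-scale = begin
        Πrhs ds                              ≡⟨ Πrhs-^ ds ⟩
        (a ^ suc q) ^ length ds * b ^ sum ds ≡⟨ cong₂ (λ r N → (a ^ suc q) ^ r * b ^ N) length-ds sum-ds ⟩
        (a ^ suc q) ^ r * b ^ (q * r + s)    ≡⟨ cong₂ _*_ a-power b-power ⟩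
        a ^ (r ∸ s) * a ^ (q * r + s) * ((b ^ q) ^ r * b ^ s)
          ≡⟨ regroup (a ^ (r ∸ s)) (a ^ (q * r + s)) ((b ^ q) ^ r) (b ^ s) ⟩
        b ^ s * a ^ (r ∸ s) * scale          ∎
        where
        open ≡-Reasoning
        regroup : ∀ A A′ B B′ → A * A′ * (B * B′) ≡ B′ * A * (B * A′)
        regroup = solve-∀
        exponents : suc q * r ≡ (r ∸ s) + (q * r + s)
        exponents = begin
          r + q * r             ≡⟨ cong (_+ q * r) (m∸n+n≡m s≤r) ⟨
          r ∸ s + s + q * r     ≡⟨ +-assoc (r ∸ s) s (q * r) ⟩
          r ∸ s + (s + q * r)   ≡⟨ cong (r ∸ s +_) (+-comm s (q * r)) ⟩
          (r ∸ s) + (q * r + s) ∎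
        a-power : (a ^ suc q) ^ r ≡ a ^ (r ∸ s) * a ^ (q * r + s)
        a-power = trans (^-*-assoc a (suc q) r)
          (trans (cong (a ^_) exponents) (^-distribˡ-+-* a (r ∸ s) (q * r + s)))
        b-power : b ^ (q * r + s) ≡ (b ^ q) ^ r * b ^ s
        b-power = trans (^-distribˡ-+-* b (q * r) s) (cong (_* b ^ s) (sym (^-*-assoc b q r)))

    Πfib₂-balanced : All Near ds → Πfib₂ ds ≡ b ^ s * a ^ (r ∸ s)
    Πfib₂-balanced near = *-cancelʳ-≡ _ _ scale {{scale≢0}}
      (trans (sym Πlhs-scale) (trans (all-near⇒≡ near) Πrhs-scale))

    Πfib₂-max : All Near ds ⊎ Πfib₂ ds < b ^ s * a ^ (r ∸ s)
    Πfib₂-max = map₂ (λ lt → *-cancelʳ-< scale _ _ (subst₂ _<_ Πlhs-scale Πrhs-scale lt))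
      (all-near⊎< ds)

  near-occurrences : ∀ {ds} → All Near ds →
    occurrences q ds + occurrences (suc q) ds ≡ length ds ×
    sum ds ≡ q * length ds + occurrences (suc q) ds
  near-occurrences [] = refl , sym (trans (+-identityʳ _) (*-zeroʳ q))
  near-occurrences {d ∷ ds} (inj₁ refl ∷ ps)
    rewrite occurrences-hit q ds | occurrences-miss ds (1+n≢n {q}) with l , m ← near-occurrences ps =
    cong suc l , trans (cong (q +_) m)
      (trans (sym (+-assoc q _ _)) (cong (_+ occurrences (suc q) ds) (sym (*-suc q (length ds)))))
  near-occurrences {d ∷ ds} (inj₂ refl ∷ ps)
    rewrite occurrences-hit (suc q) ds | occurrences-miss ds (1+n≢n {q} ∘ sym) with l , m ← near-occurrences ps =
    trans (+-suc _ _) (cong suc l) , trans (cong (suc q +_) m) (regroup q (length ds) (occurrences (suc q) ds))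
    where
    regroup : ∀ q l o → suc q + (q * l + o) ≡ q * suc l + suc o
    regroup = solve-∀

  near? : ∀ d → Near d ⊎ q ≢ d × suc q ≢ d
  near? d with q ≟ d | suc q ≟ d
  ... | yes p | _     = inj₁ (inj₁ (sym p))
  ... | no _  | yes p = inj₁ (inj₂ (sym p))
  ... | no p  | no p′ = inj₂ (p , p′)

  occurrences-≤ : ∀ ds → occurrences q ds + occurrences (suc q) ds ≤ length ds
  occurrences-≤ []       = z≤n
  occurrences-≤ (d ∷ ds) with near? d
  ... | inj₁ (inj₁ refl) rewrite occurrences-hit q ds | occurrences-miss ds (1+n≢n {q}) =
    s≤s (occurrences-≤ ds)
  ... | inj₁ (inj₂ refl) rewrite occurrences-hit (suc q) ds | occurrences-miss ds (1+n≢n {q} ∘ sym) =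
    ≤-trans (≤-reflexive (+-suc _ _)) (s≤s (occurrences-≤ ds))
  ... | inj₂ (p , p′) rewrite occurrences-miss ds p | occurrences-miss ds p′ =
    m≤n⇒m≤1+n (occurrences-≤ ds)

  -- An entry of neither value would leave the two counts adding up to more than the length of the
  -- remaining list, against `occurrences-≤`.
  occurrences-near : ∀ ds → occurrences q ds + occurrences (suc q) ds ≡ length ds → All Near ds
  occurrences-near []       _ = []
  occurrences-near (d ∷ ds) e with near? d
  ... | inj₁ (inj₁ refl) rewrite occurrences-hit q ds | occurrences-miss ds (1+n≢n {q}) =
    inj₁ refl ∷ occurrences-near ds (suc-injective e)
  ... | inj₁ (inj₂ refl) rewrite occurrences-hit (suc q) ds | occurrences-miss ds (1+n≢n {q} ∘ sym) =
    inj₂ refl ∷ occurrences-near ds (suc-injective (trans (sym (+-suc _ _)) e))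
  ... | inj₂ (p , p′) rewrite occurrences-miss ds p | occurrences-miss ds p′ =
    ⊥-elim (<⇒≱ (n<1+n (length ds)) (subst (_≤ length ds) e (occurrences-≤ ds)))

-- Extremal root sets

map-suc-surjective : ∀ {ds} → All (1 ≤_) ds → ∃[ es ] map suc es ≡ ds
map-suc-surjective []                    = [] , refl
map-suc-surjective (s≤s {n = e} _ ∷ ps) with es , refl ← map-suc-surjective ps = e ∷ es , refl

sum-map-suc : ∀ es → sum (map suc es) ≡ sum es + length es
sum-map-suc []       = refl
sum-map-suc (e ∷ es) = trans (cong (suc e +_) (sum-map-suc es)) (shuffle e (sum es) (length es))
  where
  shuffle : ∀ e s l → suc e + (s + l) ≡ e + s + suc l
  shuffle = solve-∀

sum-replicate : ∀ n x → sum (replicate n x) ≡ n * x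
sum-replicate zero    x = refl
sum-replicate (suc n) x = cong (x +_) (sum-replicate n x)

cyclicIntervals-surjective : ∀ {N} ds → All (1 ≤_) ds → 1 ≤ length ds → sum ds ≡ N →
  ∃[ R ] cyclicIntervals {N} R ≡ ds
cyclicIntervals-surjective ds ps ne refl with map-suc-surjective ps
... | e ∷ es , refl = withGaps (e ∷ es) ,
  trans (cyclicIntervals≡gaps (withGaps (e ∷ es))) (gaps-withGaps e es)

length-cyclicIntervals : ∀ {N} (R : Subset N) → length (cyclicIntervals R) ≡ ∣ R ∣
length-cyclicIntervals R = trans (cong length (cyclicIntervals≡gaps R)) (length-gaps 0 R)

sum-cyclicIntervals : ∀ {N} (R : Subset N) → 1 ≤ ∣ R ∣ → sum (cyclicIntervals R) ≡ N
sum-cyclicIntervals R ne =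
  trans (cong sum (cyclicIntervals≡gaps R)) (sum-gaps 0 R (proj₂ (nonempty R ne)))

cyclicIntervals-positive : ∀ {N} (R : Subset N) → All (1 ≤_) (cyclicIntervals R)
cyclicIntervals-positive R = subst (All (1 ≤_)) (sym (cyclicIntervals≡gaps R)) (gaps-positive 0 R)

Πfib₂-minimum : ∀ {N r} ds → All (1 ≤_) ds → 1 ≤ r → length ds ≡ r → sum ds ≡ N →
  ds ↭ (N ∸ r + 1) ∷ replicate (r ∸ 1) 1 ⊎ fib (2 * (N ∸ r + 1)) < Πfib₂ ds
Πfib₂-minimum ds ps 1≤r refl refl with map-suc-surjective ps
... | e ∷ es , refl = subst₂
  (λ d l → map suc (e ∷ es) ↭ d ∷ replicate l 1 ⊎ fib (2 * d) < Πfib₂ (map suc (e ∷ es)))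
  excess (sym (length-map suc es)) (Πfib₂-min e es)
  where
  excess : suc (sum (e ∷ es)) ≡ sum (map suc (e ∷ es)) ∸ length (map suc (e ∷ es)) + 1
  excess = begin
    suc (sum (e ∷ es))        ≡⟨ +-comm 1 (sum (e ∷ es)) ⟩
    sum (e ∷ es) + 1          ≡⟨ cong (_+ 1) (m+n∸n≡m (sum (e ∷ es)) (length (e ∷ es))) ⟨
    sum (e ∷ es) + length (e ∷ es) ∸ length (e ∷ es) + 1
      ≡⟨ cong₂ (λ m n → m ∸ suc n + 1) (sum-map-suc (e ∷ es)) (length-map suc es) ⟨
    sum (map suc (e ∷ es)) ∸ length (map suc (e ∷ es)) + 1 ∎
    where open ≡-Reasoning

module _ {A : Set} {P : Pred A 0ℓ} {f : A → ℕ} {Q : A → Set} {m : ℕ}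
  (attained : ∀ {x} → P x → Q x → f x ≡ m) {w : A} (Pw : P w) (Qw : Q w) where

  -- A maximizer failing `Q` would have a value below `m`, hence below the value at the witness `w`.
  characterise-maximum : (∀ {x} → P x → Q x ⊎ f x < m) →
    (∀ x → P x → IsMaximizer P f x ⇔ Q x) × IsMaximum P f m
  characterise-maximum strict =
    (λ x Px → mk⇔
      (λ (_ , max) → [ id , (λ lt → ⊥-elim (<⇒≱ lt (subst (_≤ f x) (attained Pw Qw) (max _ Pw)))) ]′ (strict Px))
      (λ Qx → Px , ≤-attained Px Qx)) ,
    _ , (Pw , ≤-attained Pw Qw) , attained Pw Qw
    where
    ≤-attained : ∀ {x} → P x → Q x → ∀ y → P y → f y ≤ f x
    ≤-attained {x} Px Qx y Py = subst (f y ≤_) (sym (attained Px Qx))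
      ([ ≤-reflexive ∘ attained Py , <⇒≤ ]′ (strict Py))

  characterise-minimum : (∀ {x} → P x → Q x ⊎ m < f x) →
    (∀ x → P x → IsMinimizer P f x ⇔ Q x) × IsMinimum P f m
  characterise-minimum strict =
    (λ x Px → mk⇔
      (λ (_ , min) → [ id , (λ lt → ⊥-elim (<⇒≱ lt (subst (f x ≤_) (attained Pw Qw) (min _ Pw)))) ]′ (strict Px))
      (λ Qx → Px , attained-≤ Px Qx)) ,
    _ , (Pw , attained-≤ Pw Qw) , attained Pw Qw
    where
    attained-≤ : ∀ {x} → P x → Q x → ∀ y → P y → f x ≤ f y
    attained-≤ {x} Px Qx y Py = subst (_≤ f y) (sym (attained Px Qx))
      ([ ≤-reflexive ∘ sym ∘ attained Py , <⇒≤ ]′ (strict Py))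

module _ {N r : ℕ} (f : Subset N → ℕ) (1≤r : 1 ≤ r)
  (f-Πfib₂ : ∀ R → ∣ R ∣ ≡ r → f R ≡ Πfib₂ (cyclicIntervals R)) where

  private
    HasSize : Subset N → Set
    HasSize R = ∣ R ∣ ≡ r

    length-r : ∀ R → HasSize R → length (cyclicIntervals R) ≡ r
    length-r R h = trans (length-cyclicIntervals R) h

    sum-N : ∀ R → HasSize R → sum (cyclicIntervals R) ≡ N
    sum-N R h = sum-cyclicIntervals R (subst (1 ≤_) (sym h) 1≤r)

    realise : ∀ ds → All (1 ≤_) ds → length ds ≡ r → sum ds ≡ N →
      ∃[ R ] HasSize R × cyclicIntervals R ≡ ds
    realise ds ps l m with R , e ← cyclicIntervals-surjective ds ps (subst (1 ≤_) (sym l) 1≤r) m =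
      R , trans (sym (length-cyclicIntervals R)) (trans (cong length e) l) , e

  minimum : r ≤ N →
    (∀ R → HasSize R → IsMinimizer HasSize f R ⇔ (cyclicIntervals R ↭ (N ∸ r + 1) ∷ replicate (r ∸ 1) 1))
    × IsMinimum HasSize f (fib (2 * (N ∸ r + 1)))
  minimum r≤N =
    let _ , h , b = witness in characterise-minimum attained h b strict
    where
    ds : List ℕ
    ds = (N ∸ r + 1) ∷ replicate (r ∸ 1) 1

    attained : ∀ {R} → HasSize R → cyclicIntervals R ↭ ds → f R ≡ fib (2 * (N ∸ r + 1))
    attained {R} h p = trans (f-Πfib₂ R h) (trans (Πfib₂-↭ p) (Πfib₂-concentrated (N ∸ r + 1) (r ∸ 1)))

    strict : ∀ {R} → HasSize R → cyclicIntervals R ↭ ds ⊎ fib (2 * (N ∸ r + 1)) < f R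
    strict {R} h = subst (λ k → cyclicIntervals R ↭ ds ⊎ fib (2 * (N ∸ r + 1)) < k) (sym (f-Πfib₂ R h))
      (Πfib₂-minimum (cyclicIntervals R) (cyclicIntervals-positive R) 1≤r (length-r R h) (sum-N R h))

    sum-ds : sum ds ≡ N
    sum-ds = begin
      N ∸ r + 1 + sum (replicate (r ∸ 1) 1) ≡⟨ cong (N ∸ r + 1 +_) (trans (sum-replicate (r ∸ 1) 1) (*-identityʳ _)) ⟩
      N ∸ r + 1 + (r ∸ 1)                   ≡⟨ +-assoc (N ∸ r) 1 (r ∸ 1) ⟩
      N ∸ r + (1 + (r ∸ 1))                 ≡⟨ cong (N ∸ r +_) (m+[n∸m]≡n 1≤r) ⟩
      N ∸ r + r                             ≡⟨ m∸n+n≡m r≤N ⟩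
      N                                     ∎
      where open ≡-Reasoning

    witness : ∃[ R ] HasSize R × cyclicIntervals R ↭ ds
    witness with R , h , e ← realise ds (m≤n+m 1 (N ∸ r) ∷ All.replicate⁺ (r ∸ 1) ≤-refl)
      (trans (cong suc (length-replicate (r ∸ 1))) (m+[n∸m]≡n 1≤r)) sum-ds =
      R , h , subst (_↭ ds) (sym e) ↭-refl

  maximum : ∀ {q s} → r ≤ N → N ≡ q * r + s → s < r →
    (∀ R → HasSize R → IsMaximizer HasSize f R ⇔
      (occurrences (suc q) (cyclicIntervals R) ≡ s × occurrences q (cyclicIntervals R) ≡ r ∸ s))
    × IsMaximum HasSize f (fib (2 * suc q) ^ s * fib (2 * q) ^ (r ∸ s))
  -- `q = 0` would give `N = s < r`. For positive `q`, the value `fib₂ q` is nonzero and can be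
  -- cancelled.
  maximum {zero} r≤N N≡s s<r = ⊥-elim (<⇒≱ s<r (subst (r ≤_) N≡s r≤N))
  maximum {q@(suc _)} {s} r≤N N≡qr+s s<r =
    let _ , h , b = witness in characterise-maximum attained h b strict
    where
    s≤r : s ≤ r
    s≤r = <⇒≤ s<r

    1≤q : 1 ≤ q
    1≤q = s≤s z≤n

    Balanced : List ℕ → Set
    Balanced ds = occurrences (suc q) ds ≡ s × occurrences q ds ≡ r ∸ s

    -- When all entries are `q` or `suc q`, the excess of the sum over `q * r` counts the larger
    -- ones; the length then fixes the number of smaller ones.
    near⇒balanced : ∀ ds → length ds ≡ r → sum ds ≡ N → All (Near q 1≤q) ds → Balanced ds
    near⇒balanced ds l m near with e , e′ ← near-occurrences q 1≤q near = ups ,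
      trans (sym (m+n∸n≡m _ (occurrences (suc q) ds))) (cong₂ _∸_ (trans e l) ups)
      where
      ups : occurrences (suc q) ds ≡ s
      ups = +-cancelˡ-≡ (q * r) _ _
        (trans (cong (λ l → q * l + occurrences (suc q) ds) (sym l)) (trans (sym e′) (trans m N≡qr+s)))

    balanced⇒near : ∀ ds → length ds ≡ r → Balanced ds → All (Near q 1≤q) ds
    balanced⇒near ds l (e , e′) = occurrences-near q 1≤q ds
      (trans (cong₂ _+_ e′ e) (trans (m∸n+n≡m s≤r) (sym l)))

    attained : ∀ {R} → HasSize R → Balanced (cyclicIntervals R) →
      f R ≡ fib (2 * suc q) ^ s * fib (2 * q) ^ (r ∸ s)
    attained {R} h b = trans (f-Πfib₂ R h)
      (Πfib₂-balanced q 1≤q s≤r (cyclicIntervals R) (length-r R h) (trans (sum-N R h) N≡qr+s)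
        (balanced⇒near (cyclicIntervals R) (length-r R h) b))

    strict : ∀ {R} → HasSize R →
      Balanced (cyclicIntervals R) ⊎ f R < fib (2 * suc q) ^ s * fib (2 * q) ^ (r ∸ s)
    strict {R} h = subst (λ k → Balanced (cyclicIntervals R) ⊎ k < fib (2 * suc q) ^ s * fib (2 * q) ^ (r ∸ s))
      (sym (f-Πfib₂ R h))
      (map₁ (near⇒balanced (cyclicIntervals R) (length-r R h) (sum-N R h))
        (Πfib₂-max q 1≤q s≤r (cyclicIntervals R) (length-r R h) (trans (sum-N R h) N≡qr+s)))

    ds : List ℕ
    ds = replicate s (suc q) List.++ replicate (r ∸ s) q

    near-ds : All (Near q 1≤q) ds
    near-ds = All.++⁺ (All.replicate⁺ s (inj₂ refl)) (All.replicate⁺ (r ∸ s) (inj₁ refl))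

    length-ds : length ds ≡ r
    length-ds = trans (length-++ (replicate s (suc q)))
      (trans (cong₂ _+_ (length-replicate s) (length-replicate (r ∸ s))) (m+[n∸m]≡n s≤r))

    sum-ds : sum ds ≡ N
    sum-ds = begin
      sum ds                                ≡⟨ sum-++ (replicate s (suc q)) _ ⟩
      sum (replicate s (suc q)) + sum (replicate (r ∸ s) q)
        ≡⟨ cong₂ _+_ (sum-replicate s (suc q)) (sum-replicate (r ∸ s) q) ⟩
      s * suc q + (r ∸ s) * q               ≡⟨ regroup s q (r ∸ s) ⟩
      q * (s + (r ∸ s)) + s                 ≡⟨ cong (λ k → q * k + s) (m+[n∸m]≡n s≤r) ⟩
      q * r + s                             ≡⟨ N≡qr+s ⟨
      N                                     ∎
      where
      open ≡-Reasoning
      regroup : ∀ s q k → s * suc q + k * q ≡ q * (s + k) + s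
      regroup = solve-∀

    positive : ∀ {d} → Near q 1≤q d → 1 ≤ d
    positive (inj₁ refl) = 1≤q
    positive (inj₂ refl) = z<s

    witness : ∃[ R ] HasSize R × Balanced (cyclicIntervals R)
    witness with R , h , e ← realise ds (All.map positive near-ds) length-ds sum-ds =
      R , h , subst Balanced (sym e) (near⇒balanced ds length-ds sum-ds near-ds)

theorem5p1 :
  (N r q s : ℕ) (3≤N : 3 ≤ N) → 1 ≤ r → r ≤ N → N ≡ q * r + s → s < r →
  let HasSize : Subset N → Set
      HasSize R = ∣ R ∣ ≡ r
      forests : Subset N → ℕ
      forests R = 𝓕 (wheel N 3≤N) (hub∪ R)
  in
    ((∀ R → HasSize R →
        IsMaximizer HasSize forests R ⇔
          (occurrences (q + 1) (cyclicIntervals R) ≡ s ×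
           occurrences q (cyclicIntervals R) ≡ r ∸ s))
     × IsMaximum HasSize forests (fib (2 * (q + 1)) ^ s * fib (2 * q) ^ (r ∸ s)))
  × ((∀ R → HasSize R →
        IsMinimizer HasSize forests R ⇔
          (cyclicIntervals R ↭ (N ∸ r + 1) ∷ replicate (r ∸ 1) 1))
     × IsMinimum HasSize forests (fib (2 * (N ∸ r + 1))))
theorem5p1 N r q s 3≤N 1≤r r≤N N≡qr+s s<r =
  subst (λ q+1 →
      (∀ R → ∣ R ∣ ≡ r → IsMaximizer (λ R → ∣ R ∣ ≡ r) (λ R → 𝓕 (wheel N 3≤N) (hub∪ R)) R ⇔
        (occurrences q+1 (cyclicIntervals R) ≡ s × occurrences q (cyclicIntervals R) ≡ r ∸ s))
      × IsMaximum (λ R → ∣ R ∣ ≡ r) (λ R → 𝓕 (wheel N 3≤N) (hub∪ R))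
          (fib (2 * q+1) ^ s * fib (2 * q) ^ (r ∸ s)))
    (+-comm 1 q) (maximum (λ R → 𝓕 (wheel N 3≤N) (hub∪ R)) 1≤r key r≤N N≡qr+s s<r) ,
  minimum (λ R → 𝓕 (wheel N 3≤N) (hub∪ R)) 1≤r key r≤N
  where
  key : ∀ R → ∣ R ∣ ≡ r → 𝓕 (wheel N 3≤N) (hub∪ R) ≡ Πfib₂ (cyclicIntervals R)
  key R h = 𝓕-wheel-gaps 3≤N R (subst (1 ≤_) (sym h) 1≤r)
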